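{- Let $J_{\mathrm{SK}}\subseteq\mathbb{Z}\mathfrak{S}$ be the $\mathbb{Z}$-span of all $u-v$ with $u,v$ permutations of the same size satisfying $u\equiv_{\mathrm{SK}}v$. Then $J_{\mathrm{SK}}$ is a right ideal and a coideal of the Malvenuto–Reutenauer Hopf algebra $(\mathbb{Z}\mathfrak{S},*,\Delta)$. Consequently, $\mathsf{SPR}:=\mathbb{Z}\mathfrak{S}/J_{\mathrm{SK}}$ is a right $\mathsf{PR}$-module and a quotient coalgebra of $\mathsf{PR}$.
   Context: $\mathbb{Z}\mathfrak{S}=\bigoplus_{n\ge0}\mathbb{Z}\mathfrak{S}_n$, permutations viewed as words. For a word $w$ of length $n$ over a totally ordered alphabet, $\mathrm{alph}(w)$ is its set of letters and $\mathrm{st}(w)\in\mathfrak{S}_n$ is the permutation with $\mathrm{st}(w)(i)<\mathrm{st}(w)(j)$ iff $w_i<w_j$, or $w_i=w_j$ and $i<j$. For $I\subseteq[n]$, $w|_I$ is the subword of $w$ consisting of the letters in $I$. The product and coproduct are: for $w\in\mathfrak{S}_p$, $w'\in\mathfrak{S}_q$, $w*w'=\sum uv$ over all words $u,v$ with $\mathrm{alph}(u)\cup\mathrm{alph}(v)=[p+q]$, $\mathrm{st}(u)=w$, $\mathrm{st}(v)=w'$; and for $w\in\mathfrak{S}_n$, $\Delta(w)=\sum_{i=0}^n\mathrm{st}(w|_{[1,i]})\otimes\mathrm{st}(w|_{[i+1,n]})$. Knuth equivalence $\equiv_{\mathrm{K}}$ on $\mathfrak{S}_n$ is generated by (SK1)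 $\dots xzy\dots\sim\dots zxy\dots$ for $x<y<z$ and (SK2) $\dots yxz\dots\sim\dots yzx\dots$ for $x<y<z$ (adjacent letters). Shifted Knuth equivalence $\equiv_{\mathrm{SK}}$ is generated by (SK1), (SK2) and (SK3): $xy\cdots\sim yx\cdots$ when $x,y$ are the first two letters of the permutation. $J_{\mathrm{K}}$ is the $\mathbb{Z}$-span of $u-v$ with $u\equiv_{\mathrm{K}}v$; it is a Hopf ideal, and $\mathsf{PR}=\mathbb{Z}\mathfrak{S}/J_{\mathrm{K}}$ is the Poirier–Reutenauer Hopf algebra. Since $J_{\mathrm{K}}\subseteq J_{\mathrm{SK}}$, $\mathsf{SPR}$ is a quotient of $\mathsf{PR}$. -}

module Defs where

open import Algebra.Bundles using (AbelianGroup)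
open import Algebra.Morphism.Structures using (module GroupMorphisms)
import Algebra.Properties.AbelianGroup as AbelianGroupProperties
open import Data.Fin as Fin using (Fin)
import Data.Fin.Properties as Fin
open import Data.Integer using (ℤ; 0ℤ; 1ℤ)
import Data.Integer.Properties as ℤ
open import Data.List using
  (List; []; _∷_; _++_; length; lookup; map; mapMaybe; filter; foldr; tabulate; allFin; upTo;
   cartesianProduct; cartesianProductWith)
open import Data.List.Membership.Propositional using (_∈_; lose)
open import Data.List.Membership.Propositional.Properties using
  (∈-++⁺ˡ; ∈-++⁺ʳ; ∈-++⁻; ∈-tabulate⁺; ∈-tabulate⁻; ∈-allFin)
open import Data.List.Properties using (length-tabulate; length-++; filter-notAll; ≡-dec)
import Data.List.Relation.Unary.All as All
open import Data.List.Relation.Unary.Any using (here; there)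
import Data.Maybe as Maybe
open import Data.Nat using (ℕ; zero; suc; _+_; _≤_; _<_; s≤s; z≤n; _<?_; _≤?_; _≟_)
import Data.Nat.Properties as ℕ
open import Data.List.Membership.DecPropositional _≟_ using (_∈?_)
open import Data.Product using (∃; ∃₂; _×_; _,_; proj₁; proj₂)
open import Data.Sum using (_⊎_; inj₁; inj₂)
open import Function using (_∘_; _⇔_; mk⇔; Surjective; Injective)
open import Level using (0ℓ)
open import Relation.Binary using (Rel; Setoid; tri<; tri≈; tri>)
open import Relation.Binary.Construct.Closure.Equivalence using (EqClosure)
open import Relation.Binary.PropositionalEquality using
  (_≡_; refl; sym; trans; cong; cong₂; subst)
open import Relation.Nullary using (¬_; Dec; yes; no; contradiction; dec⇒maybe)
open import Relation.Nullary.Decidable using (_×-dec_; _⊎-dec_; map′)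
open import Relation.Unary using (Pred; Decidable; _∪_; _⊆_; _≐_)

------------------------------------------------------------------------
-- Abelian groups, i.e. ℤ-modules

Ab : Set₁
Ab = AbelianGroup 0ℓ 0ℓ

∣_∣ : Ab → Set
∣_∣ = AbelianGroup.Carrier

IsLinear : (A B : Ab) → (∣ A ∣ → ∣ B ∣) → Set
IsLinear A B = GroupMorphisms.IsGroupHomomorphism (AbelianGroup.rawGroup A) (AbelianGroup.rawGroup B)

∑ : (A : Ab) → List ∣ A ∣ → ∣ A ∣
∑ A = foldr (AbelianGroup._∙_ A) (AbelianGroup.ε A)

record IsSubgroup (A : Ab) (J : Pred ∣ A ∣ 0ℓ) : Set where
  open AbelianGroup A
  field
    resp-≈     : ∀ {x y} → x ≈ y → J x → J y
    ε-closed   : J ε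
    ∙-closed   : ∀ {x y} → J x → J y → J (x ∙ y)
    ⁻¹-closed  : ∀ {x} → J x → J (x ⁻¹)

-- The ℤ-span of a set of elements.
data Span (A : Ab) (P : Pred ∣ A ∣ 0ℓ) : Pred ∣ A ∣ 0ℓ where
  incl  : ∀ {x} → P x → Span A P x
  resp  : ∀ {x y} → AbelianGroup._≈_ A x y → Span A P x → Span A P y
  zero  : Span A P (AbelianGroup.ε A)
  plus  : ∀ {x y} → Span A P x → Span A P y → Span A P (AbelianGroup._∙_ A x y)
  minus : ∀ {x} → Span A P x → Span A P (AbelianGroup._⁻¹ A x)

span-isSubgroup : (A : Ab) (P : Pred ∣ A ∣ 0ℓ) → IsSubgroup A (Span A P)
span-isSubgroup A P = record
  { resp-≈ = resp ; ε-closed = zero ; ∙-closed = plus ; ⁻¹-closed = minus }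

-- The quotient keeps the carrier; only the equality changes.
module _ (A : Ab) {J : Pred ∣ A ∣ 0ℓ} (J-isSubgroup : IsSubgroup A J) where
  private
    module A = AbelianGroup A
    module P = AbelianGroupProperties A
    open IsSubgroup J-isSubgroup
    open import Relation.Binary.Reasoning.Setoid A.setoid

    _∼_ : Rel ∣ A ∣ 0ℓ
    x ∼ y = J (x A.- y)

    ≈⇒∼ : ∀ {x y} → x A.≈ y → x ∼ y
    ≈⇒∼ {x} {y} x≈y = resp-≈ (A.sym (A.trans (A.∙-congʳ x≈y) (A.inverseʳ y))) ε-closed

    ∼-sym : ∀ {x y} → x ∼ y → y ∼ x
    ∼-sym {x} {y} p = resp-≈ eq (⁻¹-closed p)
      where
      eq : (x A.- y) A.⁻¹ A.≈ y A.- x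
      eq = begin
        (x A.- y) A.⁻¹                ≈⟨ P.⁻¹-∙-comm x (y A.⁻¹) ⟨
        x A.⁻¹ A.∙ (y A.⁻¹) A.⁻¹      ≈⟨ A.∙-congˡ (P.⁻¹-involutive y) ⟩
        x A.⁻¹ A.∙ y                  ≈⟨ A.comm _ _ ⟩
        y A.- x                       ∎

    ∼-trans : ∀ {x y z} → x ∼ y → y ∼ z → x ∼ z
    ∼-trans {x} {y} {z} p q = resp-≈ eq (∙-closed p q)
      where
      eq : (x A.- y) A.∙ (y A.- z) A.≈ x A.- z
      eq = begin
        (x A.- y) A.∙ (y A.- z)             ≈⟨ A.assoc x (y A.⁻¹) _ ⟩
        x A.∙ (y A.⁻¹ A.∙ (y A.- z))        ≈⟨ A.∙-congˡ (A.assoc (y A.⁻¹) y _) ⟨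
        x A.∙ ((y A.⁻¹ A.∙ y) A.- z)        ≈⟨ A.∙-congˡ (A.∙-congʳ (A.inverseˡ y)) ⟩
        x A.∙ (A.ε A.- z)                   ≈⟨ A.∙-congˡ (A.identityˡ _) ⟩
        x A.- z                             ∎

    ∼-cong : ∀ {x y u v} → x ∼ y → u ∼ v → (x A.∙ u) ∼ (y A.∙ v)
    ∼-cong {x} {y} {u} {v} p q = resp-≈ eq (∙-closed p q)
      where
      eq : (x A.- y) A.∙ (u A.- v) A.≈ (x A.∙ u) A.- (y A.∙ v)
      eq = begin
        (x A.- y) A.∙ (u A.- v)                 ≈⟨ A.assoc x (y A.⁻¹) _ ⟩
        x A.∙ (y A.⁻¹ A.∙ (u A.- v))            ≈⟨ A.∙-congˡ (A.assoc (y A.⁻¹) u _) ⟨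
        x A.∙ ((y A.⁻¹ A.∙ u) A.- v)            ≈⟨ A.∙-congˡ (A.∙-congʳ (A.comm _ u)) ⟩
        x A.∙ ((u A.- y) A.- v)                 ≈⟨ A.∙-congˡ (A.assoc u _ _) ⟩
        x A.∙ (u A.∙ (y A.⁻¹ A.∙ v A.⁻¹))       ≈⟨ A.assoc x u _ ⟨
        (x A.∙ u) A.∙ (y A.⁻¹ A.∙ v A.⁻¹)       ≈⟨ A.∙-congˡ (P.⁻¹-∙-comm y v) ⟩
        (x A.∙ u) A.- (y A.∙ v)                 ∎

    ∼-⁻¹ : ∀ {x y} → x ∼ y → (x A.⁻¹) ∼ (y A.⁻¹)
    ∼-⁻¹ {x} {y} p = resp-≈ (A.sym (P.⁻¹-∙-comm x (y A.⁻¹))) (⁻¹-closed p)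

  quotient : Ab
  quotient = record
    { Carrier = ∣ A ∣
    ; _≈_ = λ x y → J (x A.- y)
    ; _∙_ = A._∙_
    ; ε = A.ε
    ; _⁻¹ = A._⁻¹
    ; isAbelianGroup = record
      { isGroup = record
        { isMonoid = record
          { isSemigroup = record
            { isMagma = record
              { isEquivalence = record { refl = ≈⇒∼ A.refl ; sym = ∼-sym ; trans = ∼-trans }
              ; ∙-cong = ∼-cong }
            ; assoc = λ x y z → ≈⇒∼ (A.assoc x y z) }
          ; identity = (λ x → ≈⇒∼ (A.identityˡ x)) , (λ x → ≈⇒∼ (A.identityʳ x)) }
        ; inverse = (λ x → ≈⇒∼ (A.inverseˡ x)) , (λ x → ≈⇒∼ (A.inverseʳ x))
        ; ⁻¹-cong = ∼-⁻¹ }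
      ; comm = λ x y → ≈⇒∼ (A.comm x y) } }

-- The abelian group presented by generators G and relations R: formal
-- ℤ-linear expressions modulo the congruence generated by R and the
-- abelian group axioms.
infixl 6 _⊕_
infix  8 ⊖_

data Term (G : Set) : Set where
  gen : G → Term G
  𝟘   : Term G
  _⊕_ : Term G → Term G → Term G
  ⊖_  : Term G → Term G

data Congruence {G : Set} (R : Rel (Term G) 0ℓ) : Rel (Term G) 0ℓ where
  rel       : ∀ {s t} → R s t → Congruence R s t
  reflexive : ∀ {s} → Congruence R s s
  symmetric : ∀ {s t} → Congruence R s t → Congruence R t s
  compose   : ∀ {s t u} → Congruence R s t → Congruence R t u → Congruence R s u
  ⊕-cong    : ∀ {s s′ t t′} → Congruence R s s′ → Congruence R t t′ → Congruence R (s ⊕ t) (s′ ⊕ t′)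
  ⊖-cong    : ∀ {s t} → Congruence R s t → Congruence R (⊖ s) (⊖ t)
  ⊕-assoc   : ∀ s t u → Congruence R ((s ⊕ t) ⊕ u) (s ⊕ (t ⊕ u))
  ⊕-comm    : ∀ s t → Congruence R (s ⊕ t) (t ⊕ s)
  ⊕-idˡ     : ∀ s → Congruence R (𝟘 ⊕ s) s
  ⊖-invˡ    : ∀ s → Congruence R ((⊖ s) ⊕ s) 𝟘

presented : (G : Set) → Rel (Term G) 0ℓ → Ab
presented G R = record
  { Carrier = Term G
  ; _≈_ = Congruence R
  ; _∙_ = _⊕_
  ; ε = 𝟘
  ; _⁻¹ = ⊖_
  ; isAbelianGroup = record
    { isGroup = record
      { isMonoid = record
        { isSemigroup = record
          { isMagma = record
            { isEquivalence = record { refl = reflexive ; sym = symmetric ; trans = compose }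
            ; ∙-cong = ⊕-cong }
          ; assoc = ⊕-assoc }
        ; identity = ⊕-idˡ , (λ s → compose (⊕-comm s 𝟘) (⊕-idˡ s)) }
      ; inverse = ⊖-invˡ , (λ s → compose (⊕-comm s (⊖ s)) (⊖-invˡ s))
      ; ⁻¹-cong = ⊖-cong }
    ; comm = ⊕-comm } }

-- Linear extension of a map given on generators.
extend : {G : Set} (A : Ab) → (G → ∣ A ∣) → Term G → ∣ A ∣
extend A f (gen g) = f g
extend A f 𝟘       = AbelianGroup.ε A
extend A f (s ⊕ t) = AbelianGroup._∙_ A (extend A f s) (extend A f t)
extend A f (⊖ s)   = AbelianGroup._⁻¹ A (extend A f s)

data FreeRel (X : Setoid 0ℓ 0ℓ) : Rel (Term (Setoid.Carrier X)) 0ℓ where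
  gen-cong : ∀ {x y} → Setoid._≈_ X x y → FreeRel X (gen x) (gen y)

free : Setoid 0ℓ 0ℓ → Ab
free X = presented (Setoid.Carrier X) (FreeRel X)

data TensorRel (A B : Ab) : Rel (Term (∣ A ∣ × ∣ B ∣)) 0ℓ where
  ⊗-cong   : ∀ {a a′ b b′} → AbelianGroup._≈_ A a a′ → AbelianGroup._≈_ B b b′ →
             TensorRel A B (gen (a , b)) (gen (a′ , b′))
  ⊗-distˡ  : ∀ a b b′ → TensorRel A B (gen (a , AbelianGroup._∙_ B b b′)) (gen (a , b) ⊕ gen (a , b′))
  ⊗-distʳ  : ∀ a a′ b → TensorRel A B (gen (AbelianGroup._∙_ A a a′ , b)) (gen (a , b) ⊕ gen (a′ , b))

infixr 7 _⊗_ _⊗ₑ_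

_⊗_ : Ab → Ab → Ab
A ⊗ B = presented (∣ A ∣ × ∣ B ∣) (TensorRel A B)

_⊗ₑ_ : {X Y : Set} → X → Y → Term (X × Y)
a ⊗ₑ b = gen (a , b)

-- f ⊗ g, with codomain A ⊗ B
tensorMap : (A B : Ab) {X Y : Set} → (X → ∣ A ∣) → (Y → ∣ B ∣) → Term (X × Y) → ∣ A ⊗ B ∣
tensorMap A B f g = extend (A ⊗ B) (λ (x , y) → f x ⊗ₑ g y)

-- The canonical isomorphism (A ⊗ B) ⊗ C → A ⊗ (B ⊗ C)
associator : (A B C : Ab) → ∣ (A ⊗ B) ⊗ C ∣ → ∣ A ⊗ (B ⊗ C) ∣
associator A B C =
  extend (A ⊗ (B ⊗ C)) (λ (t , c) → extend (A ⊗ (B ⊗ C)) (λ (a , b) → a ⊗ₑ (b ⊗ₑ c)) t)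

ℤ-group : Ab
ℤ-group = ℤ.+-0-abelianGroup

------------------------------------------------------------------------
-- Ideals, coideals, coalgebras

record IsRightIdeal (A : Ab) (_*_ : ∣ A ∣ → ∣ A ∣ → ∣ A ∣) (J : Pred ∣ A ∣ 0ℓ) : Set where
  field
    isSubgroup : IsSubgroup A J
    absorbs    : ∀ {a} b → J a → J (a * b)

-- J ⊗ C + C ⊗ J, as a subgroup of C ⊗ C
TensorIdeal : (C : Ab) → Pred ∣ C ∣ 0ℓ → Pred ∣ C ⊗ C ∣ 0ℓ
TensorIdeal C J = Span (C ⊗ C) (λ t → ∃₂ λ a b → (J a ⊎ J b) × t ≡ a ⊗ₑ b)

record IsCoideal (C : Ab) (Δ : ∣ C ∣ → ∣ C ⊗ C ∣) (ε : ∣ C ∣ → ℤ) (J : Pred ∣ C ∣ 0ℓ) : Set where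
  field
    isSubgroup : IsSubgroup C J
    Δ-coideal  : ∀ {a} → J a → TensorIdeal C J (Δ a)
    ε-coideal  : ∀ {a} → J a → ε a ≡ 0ℤ

-- The counit laws are stated through the isomorphisms C → ℤ ⊗ C and
-- C → C ⊗ ℤ.
record IsCoalgebra (C : Ab) (Δ : ∣ C ∣ → ∣ C ⊗ C ∣) (ε : ∣ C ∣ → ℤ) : Set where
  private
    id : ∣ C ∣ → ∣ C ∣
    id c = c
  field
    Δ-linear : IsLinear C (C ⊗ C) Δ
    ε-linear : IsLinear C ℤ-group ε
    coassoc  : ∀ c → AbelianGroup._≈_ (C ⊗ (C ⊗ C))
                       (associator C C C (tensorMap (C ⊗ C) C Δ id (Δ c)))
                       (tensorMap C (C ⊗ C) id Δ (Δ c))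
    counitˡ  : ∀ c → AbelianGroup._≈_ (ℤ-group ⊗ C) (tensorMap ℤ-group C ε id (Δ c)) (1ℤ ⊗ₑ c)
    counitʳ  : ∀ c → AbelianGroup._≈_ (C ⊗ ℤ-group) (tensorMap C ℤ-group id ε (Δ c)) (c ⊗ₑ 1ℤ)

record IsQuotientCoalgebra
  (C : Ab) (Δ : ∣ C ∣ → ∣ C ⊗ C ∣) (ε : ∣ C ∣ → ℤ)
  (D : Ab) (Δ′ : ∣ D ∣ → ∣ D ⊗ D ∣) (ε′ : ∣ D ∣ → ℤ)
  (π : ∣ C ∣ → ∣ D ∣) : Set where
  field
    isCoalgebra  : IsCoalgebra C Δ ε
    isCoalgebra′ : IsCoalgebra D Δ′ ε′
    π-linear     : IsLinear C D π
    π-surjective : Surjective (AbelianGroup._≈_ C) (AbelianGroup._≈_ D) π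
    π-Δ          : ∀ c → AbelianGroup._≈_ (D ⊗ D) (Δ′ (π c)) (tensorMap D D π π (Δ c))
    π-ε          : ∀ c → ε′ (π c) ≡ ε c

------------------------------------------------------------------------
-- Words and permutations

Word : Set
Word = List ℕ

alph : Word → Pred ℕ 0ℓ
alph w k = k ∈ w

[_‥_] : ℕ → ℕ → Pred ℕ 0ℓ
[ a ‥ b ] k = a ≤ k × k ≤ b

infix 8 _∣[_‥_]

_∣[_‥_] : Word → ℕ → ℕ → Word
w ∣[ a ‥ b ] = filter (λ k → (a ≤? k) ×-dec (k ≤? b)) w

-- A word of length n with letter set {1, …, n} has no repeated letter.
IsPermutation : Pred Word 0ℓ
IsPermutation w = alph w ≐ [ 1 ‥ length w ]

-- All permutations of all sizes, in one-line notation.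
record Permutation : Set where
  constructor perm
  field
    word          : Word
    isPermutation : IsPermutation word

open Permutation public

size : Permutation → ℕ
size w = length (word w)

permutationSetoid : Setoid 0ℓ 0ℓ
permutationSetoid = record
  { Carrier = Permutation
  ; _≈_ = λ u v → word u ≡ word v
  ; isEquivalence = record { refl = refl ; sym = sym ; trans = trans } }

------------------------------------------------------------------------
-- Standardization

Before : (w : Word) → Rel (Fin (length w)) 0ℓ
Before w i j = lookup w i < lookup w j ⊎ (lookup w i ≡ lookup w j × i Fin.< j)

before? : (w : Word) → (i j : Fin (length w)) → Dec (Before w i j)
before? w i j = (lookup w i <? lookup w j) ⊎-dec ((lookup w i ≟ lookup w j) ×-dec (i Fin.<? j))

rank : (w : Word) → Fin (length w) → ℕ
rank w i = suc (length (filter (λ j → before? w j i) (allFin (length w))))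

st : Word → Word
st w = tabulate (rank w)

length-st : ∀ w → length (st w) ≡ length w
length-st w = length-tabulate (rank w)

private
  before-irrefl : ∀ w i → ¬ Before w i i
  before-irrefl w i (inj₁ p)       = ℕ.<-irrefl refl p
  before-irrefl w i (inj₂ (_ , p)) = ℕ.<-irrefl refl p

  before-trans : ∀ w {i j k} → Before w i j → Before w j k → Before w i k
  before-trans w (inj₁ p)       (inj₁ q)       = inj₁ (ℕ.<-trans p q)
  before-trans w (inj₁ p)       (inj₂ (q , _)) = inj₁ (ℕ.<-≤-trans p (ℕ.≤-reflexive q))
  before-trans w (inj₂ (p , _)) (inj₁ q)       = inj₁ (ℕ.≤-<-trans (ℕ.≤-reflexive p) q)
  before-trans w (inj₂ (p , a)) (inj₂ (q , b)) = inj₂ (trans p q , ℕ.<-trans a b)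

  before-total : ∀ w i j → ¬ i ≡ j → Before w i j ⊎ Before w j i
  before-total w i j i≢j with ℕ.<-cmp (lookup w i) (lookup w j) | Fin.<-cmp i j
  ... | tri< p _ _ | _          = inj₁ (inj₁ p)
  ... | tri> _ _ p | _          = inj₂ (inj₁ p)
  ... | tri≈ _ p _ | tri< q _ _ = inj₁ (inj₂ (p , q))
  ... | tri≈ _ p _ | tri≈ _ q _ = contradiction q i≢j
  ... | tri≈ _ p _ | tri> _ _ q = inj₂ (inj₂ (sym p , q))

  module _ {X : Set} {P Q : Pred X 0ℓ} (P? : Decidable P) (Q? : Decidable Q) (P⊆Q : P ⊆ Q) where

    filter-mono : ∀ xs → length (filter P? xs) ≤ length (filter Q? xs)
    filter-mono [] = z≤n
    filter-mono (x ∷ xs) with P? x | Q? x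
    ... | yes p | yes q = s≤s (filter-mono xs)
    ... | yes p | no ¬q = contradiction (P⊆Q p) ¬q
    ... | no ¬p | yes q = ℕ.m≤n⇒m≤1+n (filter-mono xs)
    ... | no ¬p | no ¬q = filter-mono xs

    filter-strict : ∀ {x} xs → x ∈ xs → ¬ P x → Q x → length (filter P? xs) < length (filter Q? xs)
    filter-strict (x ∷ xs) (here refl) ¬p q with P? x | Q? x
    ... | yes p | _      = contradiction p ¬p
    ... | no _  | yes _  = s≤s (filter-mono xs)
    ... | no _  | no ¬q  = contradiction q ¬q
    filter-strict (y ∷ xs) (there x∈xs) ¬p q with P? y | Q? y
    ... | yes p | yes q′ = s≤s (filter-strict xs x∈xs ¬p q)
    ... | yes p | no ¬q  = contradiction (P⊆Q p) ¬q
    ... | no _  | yes _  = ℕ.m≤n⇒m≤1+n (filter-strict xs x∈xs ¬p q)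
    ... | no _  | no _   = filter-strict xs x∈xs ¬p q

  rank-mono : ∀ w {i j} → Before w i j → rank w i < rank w j
  rank-mono w {i} {j} b = s≤s (filter-strict (λ k → before? w k i) (λ k → before? w k j)
    (λ c → before-trans w c b) (allFin (length w)) (∈-allFin i) (before-irrefl w i) b)

-- The defining property of standardization.
rank-spec : ∀ w i j → rank w i < rank w j ⇔ Before w i j
rank-spec w i j = mk⇔ to (rank-mono w)
  where
  to : rank w i < rank w j → Before w i j
  to p with i Fin.≟ j
  ... | yes refl = contradiction p (ℕ.<-irrefl refl)
  ... | no i≢j with before-total w i j i≢j
  ...   | inj₁ b = b
  ...   | inj₂ b = contradiction (rank-mono w b) (ℕ.<-asym p)

private
  rank-injective : ∀ w → Injective _≡_ _≡_ (rank w)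
  rank-injective w {i} {j} eq with i Fin.≟ j
  ... | yes i≡j = i≡j
  ... | no i≢j with before-total w i j i≢j
  ...   | inj₁ b = contradiction (rank-mono w b) (ℕ.<-irrefl eq)
  ...   | inj₂ b = contradiction (rank-mono w b) (ℕ.<-irrefl (sym eq))

  rank-≤ : ∀ w i → rank w i ≤ length w
  rank-≤ w i = subst (rank w i ≤_) (length-tabulate {n = length w} (λ k → k))
    (filter-notAll (λ j → before? w j i) (allFin (length w)) (lose (∈-allFin i) (before-irrefl w i)))

  injective⇒onto : ∀ {n} (f : Fin n → Fin n) → Injective _≡_ _≡_ f → ∀ y → ∃ λ x → f x ≡ y
  injective⇒onto {zero}  f inj ()
  injective⇒onto {suc n} f inj y with Fin.any? (λ x → f x Fin.≟ y)
  ... | yes p = p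
  ... | no ¬p = contradiction (Fin.injective⇒≤ g-inj) ℕ.1+n≰n
    where
    avoids : ∀ x → ¬ y ≡ f x
    avoids x eq = ¬p (x , sym eq)
    g : Fin (suc n) → Fin n
    g x = Fin.punchOut (avoids x)
    g-inj : Injective _≡_ _≡_ g
    g-inj {x} {x′} eq = inj (Fin.punchOut-injective (avoids x) (avoids x′) eq)

st-isPermutation : ∀ w → IsPermutation (st w)
st-isPermutation w = fwd , bwd
  where
  n : ℕ
  n = length w
  fwd : ∀ {k} → k ∈ st w → [ 1 ‥ length (st w) ] k
  fwd k∈ with ∈-tabulate⁻ k∈
  ... | i , refl = s≤s z≤n , subst (rank w i ≤_) (sym (length-st w)) (rank-≤ w i)
  rank₀ : Fin n → Fin n
  rank₀ i = Fin.fromℕ< {m = length (filter (λ j → before? w j i) (allFin n))} (rank-≤ w i)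
  toℕ-rank₀ : ∀ i → suc (Fin.toℕ (rank₀ i)) ≡ rank w i
  toℕ-rank₀ i = cong suc (Fin.toℕ-fromℕ< (rank-≤ w i))
  rank₀-inj : Injective _≡_ _≡_ rank₀
  rank₀-inj {i} {j} eq =
    rank-injective w (trans (sym (toℕ-rank₀ i)) (trans (cong (suc ∘ Fin.toℕ) eq) (toℕ-rank₀ j)))
  bwd : ∀ {k} → [ 1 ‥ length (st w) ] k → k ∈ st w
  bwd {zero}  (() , _)
  bwd {suc k} (_ , k<) with injective⇒onto rank₀ rank₀-inj (Fin.fromℕ< k<n)
    where
    k<n : k < n
    k<n = subst (suc k ≤_) (length-st w) k<
  ... | i , eq = subst (_∈ st w)
    (trans (sym (toℕ-rank₀ i)) (cong suc (trans (cong Fin.toℕ eq) (Fin.toℕ-fromℕ< _))))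
    (∈-tabulate⁺ i)

std : Word → Permutation
std w = perm (st w) (st-isPermutation w)

------------------------------------------------------------------------
-- The Malvenuto–Reutenauer algebra

ℤ𝔖 : Ab
ℤ𝔖 = free permutationSetoid

words : ℕ → ℕ → List Word
words m zero    = [] ∷ []
words m (suc n) = cartesianProductWith _∷_ (map suc (upTo m)) (words m n)

-- The words u, v contributing uv to the product w * w′.
Contributes : (w w′ : Permutation) → Pred (Word × Word) 0ℓ
Contributes w w′ (u , v) =
  (alph u ∪ alph v ≐ [ 1 ‥ size w + size w′ ]) × st u ≡ word w × st v ≡ word w′

contributes? : (w w′ : Permutation) → Decidable (Contributes w w′)
contributes? w w′ (u , v) =
  (fwd? ×-dec bwd?) ×-dec (≡-dec _≟_ (st u) (word w) ×-dec ≡-dec _≟_ (st v) (word w′))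
  where
  n : ℕ
  n = size w + size w′
  inRange? : Decidable [ 1 ‥ n ]
  inRange? k = (1 ≤? k) ×-dec (k ≤? n)
  fwd? : Dec (alph u ∪ alph v ⊆ [ 1 ‥ n ])
  fwd? = map′
    (λ (a , b) → λ { (inj₁ k∈u) → All.lookup a k∈u ; (inj₂ k∈v) → All.lookup b k∈v })
    (λ f → All.tabulate (λ k∈u → f (inj₁ k∈u)) , All.tabulate (λ k∈v → f (inj₂ k∈v)))
    (All.all? inRange? u ×-dec All.all? inRange? v)
  bwd? : Dec ([ 1 ‥ n ] ⊆ alph u ∪ alph v)
  bwd? = map′
    (λ a → λ { {zero} (() , _) ; {suc k} (_ , k<n) → a k<n })
    (λ f {k} k<n → f (s≤s z≤n , k<n))
    (ℕ.allUpTo? (λ k → (suc k ∈? u) ⊎-dec (suc k ∈? v)) n)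

concatenation : ∀ {w w′ : Permutation} {u v} → Contributes w w′ (u , v) → Permutation
concatenation {w} {w′} {u} {v} ((fwd , bwd) , stu , stv) = perm (u ++ v) (fwd′ , bwd′)
  where
  length-eq : ∀ x (y : Permutation) → st x ≡ word y → length x ≡ size y
  length-eq x y eq = trans (sym (length-st x)) (cong length eq)
  eq : length (u ++ v) ≡ size w + size w′
  eq = trans (length-++ u) (cong₂ _+_ (length-eq u w stu) (length-eq v w′ stv))
  fwd′ : alph (u ++ v) ⊆ [ 1 ‥ length (u ++ v) ]
  fwd′ {k} k∈ = subst (λ m → [ 1 ‥ m ] k) (sym eq) (fwd (∈-++⁻ u k∈))
  bwd′ : [ 1 ‥ length (u ++ v) ] ⊆ alph (u ++ v)
  bwd′ {k} r with bwd (subst (λ m → [ 1 ‥ m ] k) eq r)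
  ... | inj₁ k∈u = ∈-++⁺ˡ k∈u
  ... | inj₂ k∈v = ∈-++⁺ʳ u k∈v

select : {X : Set} {P : Pred X 0ℓ} → Decidable P → List X → List (∃ P)
select P? = mapMaybe (λ x → Maybe.map (x ,_) (dec⇒maybe (P? x)))

-- The letters and lengths of contributing u, v are forced by Contributes,
-- so restricting the search to these finitely many words loses nothing.
contributions : (w w′ : Permutation) → List (∃ (Contributes w w′))
contributions w w′ = select (contributes? w w′)
  (cartesianProduct (words (size w + size w′) (size w)) (words (size w + size w′) (size w′)))

infixl 7 _✶_

_✶_ : ∣ ℤ𝔖 ∣ → ∣ ℤ𝔖 ∣ → ∣ ℤ𝔖 ∣
a ✶ b = extend ℤ𝔖 (λ w → extend ℤ𝔖 (λ w′ →
  ∑ ℤ𝔖 (map (λ (_ , c) → gen (concatenation {w} {w′} c)) (contributions w w′))) b) a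

-- the empty permutation
𝟙 : ∣ ℤ𝔖 ∣
𝟙 = gen (std [])

Δ : ∣ ℤ𝔖 ∣ → ∣ ℤ𝔖 ⊗ ℤ𝔖 ∣
Δ = extend (ℤ𝔖 ⊗ ℤ𝔖) λ w → ∑ (ℤ𝔖 ⊗ ℤ𝔖)
  (map (λ i → gen (std (word w ∣[ 1 ‥ i ])) ⊗ₑ gen (std (word w ∣[ suc i ‥ size w ])))
       (upTo (suc (size w))))

-- The counit: the coefficient of the empty permutation.
counit : ∣ ℤ𝔖 ∣ → ℤ
counit = extend ℤ-group (λ w → onWord (word w))
  where
  onWord : Word → ℤ
  onWord []      = 1ℤ
  onWord (_ ∷ _) = 0ℤ

------------------------------------------------------------------------
-- Knuth and shifted Knuth equivalence

infix 4 _∼K_ _∼SK_ _≡K_ _≡SK_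

data _∼K_ : Rel Word 0ℓ where
  SK1 : ∀ s t {x y z} → x < y → y < z → s ++ x ∷ z ∷ y ∷ t ∼K s ++ z ∷ x ∷ y ∷ t
  SK2 : ∀ s t {x y z} → x < y → y < z → s ++ y ∷ x ∷ z ∷ t ∼K s ++ y ∷ z ∷ x ∷ t

data _∼SK_ : Rel Word 0ℓ where
  knuth : ∀ {u v} → u ∼K v → u ∼SK v
  SK3   : ∀ x y t → x ∷ y ∷ t ∼SK y ∷ x ∷ t

-- Every move permutes the letters of a word, so a chain of moves starting
-- at a permutation consists of permutations of the same size.
_≡K_ : Rel Permutation 0ℓ
u ≡K v = EqClosure _∼K_ (word u) (word v)

_≡SK_ : Rel Permutation 0ℓ
u ≡SK v = EqClosure _∼SK_ (word u) (word v)

Differences : Rel Permutation 0ℓ → Pred ∣ ℤ𝔖 ∣ 0ℓ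
Differences R a = ∃₂ λ u v → R u v × a ≡ gen u ⊕ ⊖ gen v

J-K : Pred ∣ ℤ𝔖 ∣ 0ℓ
J-K = Span ℤ𝔖 (Differences _≡K_)

J-SK : Pred ∣ ℤ𝔖 ∣ 0ℓ
J-SK = Span ℤ𝔖 (Differences _≡SK_)

PR : Ab
PR = quotient ℤ𝔖 (span-isSubgroup ℤ𝔖 (Differences _≡K_))

SPR : Ab
SPR = quotient ℤ𝔖 (span-isSubgroup ℤ𝔖 (Differences _≡SK_))

-- Quotients share their carrier with ℤ𝔖, so the operations induced on
-- them by _✶_, Δ and counit are given by the same functions; that they
-- are well defined is part of the congruence fields of IsRing,
-- IsRightModule and IsLinear.
_*PR_ : ∣ PR ∣ → ∣ PR ∣ → ∣ PR ∣
a *PR b = a ✶ b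

_·_ : ∣ SPR ∣ → ∣ PR ∣ → ∣ SPR ∣
m · a = m ✶ a

Δ-PR : ∣ PR ∣ → ∣ PR ⊗ PR ∣
Δ-PR = Δ

Δ-SPR : ∣ SPR ∣ → ∣ SPR ⊗ SPR ∣
Δ-SPR = Δ

projection : ∣ PR ∣ → ∣ SPR ∣
projection a = a

{-# OPTIONS --safe #-}

-- The words y in the product of u and v are the permutations whose prefix
-- standardizes to u and whose suffix standardizes to v. Hence a Knuth move on
-- u, being an exchange of adjacent letters that depends only on their relative
-- order, lifts to the same move on y, and y ↦ "y with these two positions
-- exchanged" is a bijection between the terms of the two products. (SK3) acts
-- on the first two letters, which survives for the prefix but not for the
-- suffix, so that J_SK is only a right ideal. For the coproduct, restricting
-- a word to an interval of letters turns a move into a move or into an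
-- equality, because an interval containing x and z contains every y between.

module Submission where

open import Defs
open import Algebra.Bundles using (AbelianGroup)
import Algebra.Properties.AbelianGroup as AbelianGroupProperties
import Algebra.Properties.CommutativeSemigroup as CommutativeSemigroupProperties
open import Algebra.Structures using (IsRing)
open import Algebra.Module.Structures using (IsRightModule)
open import Data.Fin as Fin using (Fin)
open import Data.Integer.Base using (0ℤ; 1ℤ)
open import Data.List.Base using
  (List; []; _∷_; _++_; length; lookup; map; filter; foldr; concatMap; cartesianProduct; tabulate;
   allFin; upTo; applyUpTo; take; drop)
open import Data.List.Properties using
  (map-∘; map-cong; map-cong-local; map-id-local; map-++; map-tabulate; map-upTo; tabulate-cong;
   tabulate-lookup; length-map; length-++; length-applyUpTo; length-take; length-drop; filter-all;
   filter-notAll; filter-++; take-map; drop-map; take-take; drop-drop; take-all; drop-all;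
   take++drop≡id; ∷-injective)
open import Data.List.Membership.Propositional using (_∈_; find; lose)
open import Data.List.Membership.Propositional.Properties
open import Data.List.Membership.Propositional.Properties.WithK using (unique∧set⇒bag)
open import Data.List.Relation.Binary.BagAndSetEquality using (∼bag⇒↭)
open import Data.List.Relation.Binary.Permutation.Propositional using
  (_↭_; prep; swap; ↭-refl; ↭-sym; ↭-trans; ↭⇒↭ₛ)
import Data.List.Relation.Binary.Permutation.Propositional as Perm
open import Data.List.Relation.Binary.Permutation.Propositional.Properties using
  (filter-↭; shift; ↭-length; ∈-resp-↭)
import Data.List.Relation.Binary.Permutation.Setoid.Properties as PermutationS
open import Data.List.Relation.Unary.All as All using ([]; _∷_)
open import Data.List.Relation.Unary.All.Properties using (All¬⇒¬Any; ¬Any⇒All¬)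
open import Data.List.Relation.Unary.AllPairs using ([]; _∷_)
open import Data.List.Relation.Unary.Any using (here; there)
open import Data.List.Relation.Unary.Any.Properties using (concatMap⁺; concatMap⁻)
open import Data.List.Relation.Unary.Unique.Propositional using (Unique)
import Data.List.Relation.Unary.Unique.Propositional.Properties as Unique
open import Data.Nat.Base using (ℕ; zero; suc; _+_; _∸_; _≤_; _<_; z≤n; s≤s)
open import Data.Nat.Properties as ℕ using (_<?_; _≤?_)
open import Data.Product using (Σ; ∃; _×_; _,_; proj₁; proj₂; uncurry)
open import Data.Sum using (_⊎_; inj₁; inj₂; [_,_]′)
open import Function using (_∘_; _⇔_; mk⇔; Equivalence)
open import Level using (0ℓ)
open import Relation.Binary using (Rel; tri<; tri≈; tri>)
open import Relation.Binary.Construct.Closure.Equivalence as EqClosure using (EqClosure)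
open import Relation.Binary.Construct.Closure.ReflexiveTransitive using (ε; _◅_)
open import Relation.Binary.Construct.Closure.Symmetric using (fwd; bwd)
open import Relation.Binary.PropositionalEquality using
  (_≡_; refl; sym; trans; cong; cong₂; subst; subst₂; setoid; module ≡-Reasoning)
import Relation.Binary.Reasoning.Setoid as SetoidReasoning
open import Relation.Nullary using (¬_; yes; no; contradiction)
open import Relation.Nullary.Decidable using (_×-dec_)
open import Relation.Unary using (Pred; Decidable)

open Equivalence using (to; from)

-- `st` breaks ties by position, but every word whose standardization is computed below is free of
-- repetitions, and there `st w` is the image of `w` under a strictly increasing function. This one
-- fact makes `st` commute with prefixes, suffixes, exchanges and restrictions. Sums are compared
-- through membership. The list of terms of a product has no repetitions, so two such sums agree as
-- soon as the same words occur in both; the exchange bijection and associativity thus become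
-- equivalences of predicates on words. Both relations are instances of one interface of moves
-- indexed by a position, and what they share is proved once. Stability of a move under prepending
-- letters is a separate hypothesis, supplied for Knuth moves; it makes J_K a left ideal as well.
-- That is what the module structure requires: the action of PR on SPR respects equality in PR
-- because J_K absorbs products from the left and lies in J_SK. The coalgebra laws are checked in
-- the quotient by an arbitrary coideal, and so serve PR and SPR at once.

private
  module ℤ𝔖 = AbelianGroup ℤ𝔖

-- Standardization

module _ {X : Set} where

  filter-cong : {P Q : Pred X 0ℓ} (P? : Decidable P) (Q? : Decidable Q) (xs : List X) →
                (∀ {x} → x ∈ xs → P x ⇔ Q x) → filter P? xs ≡ filter Q? xs
  filter-cong P? Q? [] P⇔Q = refl
  filter-cong P? Q? (x ∷ xs) P⇔Q with P? x | Q? x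
  ... | yes _ | yes _ = cong (x ∷_) (filter-cong P? Q? xs (P⇔Q ∘ there))
  ... | no _  | no _  = filter-cong P? Q? xs (P⇔Q ∘ there)
  ... | yes p | no ¬q = contradiction (Equivalence.to (P⇔Q (here refl)) p) ¬q
  ... | no ¬p | yes q = contradiction (Equivalence.from (P⇔Q (here refl)) q) ¬p

  filter-map : {Y : Set} {P : Pred Y 0ℓ} (P? : Decidable P) (f : X → Y) (xs : List X) →
               filter P? (map f xs) ≡ map f (filter (P? ∘ f) xs)
  filter-map P? f [] = refl
  filter-map P? f (x ∷ xs) with P? (f x)
  ... | yes _ = cong (f x ∷_) (filter-map P? f xs)
  ... | no _  = filter-map P? f xs

  filter-filter : {P Q : Pred X 0ℓ} (P? : Decidable P) (Q? : Decidable Q) (xs : List X) →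
                  filter Q? (filter P? xs) ≡ filter (λ x → P? x ×-dec Q? x) xs
  filter-filter P? Q? [] = refl
  filter-filter P? Q? (x ∷ xs) with P? x
  ... | no _ = filter-filter P? Q? xs
  ... | yes _ with Q? x
  ...   | yes _ = cong (x ∷_) (filter-filter P? Q? xs)
  ...   | no _  = filter-filter P? Q? xs

  unique-map : {Y : Set} {f : X → Y} {xs : List X} →
               (∀ {x y} → x ∈ xs → y ∈ xs → f x ≡ f y → x ≡ y) → Unique xs → Unique (map f xs)
  unique-map inj [] = []
  unique-map {f = f} {x ∷ xs} inj (x∉ ∷ xs!) =
    ¬Any⇒All¬ _ fx∉ ∷ unique-map (λ a b → inj (there a) (there b)) xs!
    where
    fx∉ : ¬ f x ∈ map f xs
    fx∉ fx∈ with ∈-map⁻ f fx∈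
    ... | y , y∈ , eq with refl ← inj (here refl) (there y∈) eq = All¬⇒¬Any x∉ y∈

  unique-resp-↭ : {xs ys : List X} → xs ↭ ys → Unique xs → Unique ys
  unique-resp-↭ p = PermutationS.Unique-resp-↭ (setoid X) (↭⇒↭ₛ p)

  unique-set⇒↭ : {xs ys : List X} → Unique xs → Unique ys → (∀ {x} → x ∈ xs ⇔ x ∈ ys) → xs ↭ ys
  unique-set⇒↭ xs! ys! eq = ∼bag⇒↭ (unique∧set⇒bag xs! ys! eq)

  -- Pigeonhole principle: remove the head of `xs` from `ys` and recurse. It extracts freedom from
  -- repetitions out of `IsPermutation`, which speaks only of the letter set and the length.
  unique-⊆⇒↭ : {xs ys : List X} → Unique xs → (∀ {x} → x ∈ xs → x ∈ ys) →
                length ys ≤ length xs → xs ↭ ys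
  unique-⊆⇒↭ {[]}     {[]}    _           _  _   = ↭-refl
  unique-⊆⇒↭ {x ∷ xs}         (x∉ ∷ xs!) ⊆ len with ∈-∃++ (⊆ (here refl))
  ... | as , bs , refl = ↭-trans (prep x (unique-⊆⇒↭ xs! ⊆′ len′)) (↭-sym (shift x as bs))
    where
    ⊆′ : ∀ {y} → y ∈ xs → y ∈ as ++ bs
    ⊆′ y∈ with ∈-resp-↭ (shift x as bs) (⊆ (there y∈))
    ... | here refl = contradiction y∈ (All¬⇒¬Any x∉)
    ... | there y∈′ = y∈′
    len′ : length (as ++ bs) ≤ length xs
    len′ = ℕ.≤-pred (subst (_≤ _) (↭-length (shift x as bs)) len)

-- The letters following `a`, with their number `m` instead of an upper end, so that consecutive
-- cuts add up and no subtraction occurs.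
interval : ℕ → ℕ → Word
interval a m = applyUpTo (λ k → suc (a + k)) m

∈-interval : ∀ {a m k} → k ∈ interval a m ⇔ [ suc a ‥ a + m ] k
∈-interval {a} {m} {k} = mk⇔ ⊆ ⊇
  where
  ⊆ : k ∈ interval a m → [ suc a ‥ a + m ] k
  ⊆ k∈ with ∈-applyUpTo⁻ _ k∈
  ... | i , i<m , refl = s≤s (ℕ.m≤m+n a i) , subst (_≤ a + m) (ℕ.+-suc a i) (ℕ.+-monoʳ-≤ a i<m)
  ⊇ : [ suc a ‥ a + m ] k → k ∈ interval a m
  ⊇ (a<k , k≤) with ℕ.m≤n⇒∃[o]m+o≡n a<k
  ... | i , refl = ∈-applyUpTo⁺ _ (ℕ.+-cancelˡ-≤ a _ _ (subst (_≤ a + m) (sym (ℕ.+-suc a i)) k≤))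

interval-unique : ∀ a m → Unique (interval a m)
interval-unique a m = Unique.applyUpTo⁺₁ _ m λ i<j _ eq →
  ℕ.<⇒≢ i<j (ℕ.+-cancelˡ-≡ a _ _ (ℕ.suc-injective eq))

permutation-↭ : ∀ {w} → IsPermutation w → interval 0 (length w) ↭ w
permutation-↭ {w} (_ , ⊇) = unique-⊆⇒↭ (interval-unique 0 _) (⊇ ∘ Equivalence.to ∈-interval)
  (ℕ.≤-reflexive (sym (length-applyUpTo suc _)))

permutation-unique : ∀ {w} → IsPermutation w → Unique w
permutation-unique p = unique-resp-↭ (permutation-↭ p) (interval-unique 0 _)

permutation-resp-↭ : ∀ {u v} → u ↭ v → IsPermutation u → IsPermutation v
permutation-resp-↭ {u} {v} u↭v (⊆ , ⊇) =
  (λ k∈ → subst (λ n → [ 1 ‥ n ] _) (↭-length u↭v) (⊆ (∈-resp-↭ (↭-sym u↭v) k∈))) ,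
  (λ k∈ → ∈-resp-↭ u↭v (⊇ (subst (λ n → [ 1 ‥ n ] _) (sym (↭-length u↭v)) k∈)))

-- Standardization as a strictly increasing relabelling

StrictlyMonotoneOn : Word → (ℕ → ℕ) → Set
StrictlyMonotoneOn w f = ∀ {a b} → a ∈ w → b ∈ w → a < b → f a < f b

module _ {w : Word} {f : ℕ → ℕ} (mono : StrictlyMonotoneOn w f) where

  monotone-injective : ∀ {a b} → a ∈ w → b ∈ w → f a ≡ f b → a ≡ b
  monotone-injective {a} {b} a∈ b∈ eq with ℕ.<-cmp a b
  ... | tri< a<b _ _ = contradiction eq (ℕ.<⇒≢ (mono a∈ b∈ a<b))
  ... | tri≈ _ a≡b _ = a≡b
  ... | tri> _ _ b<a = contradiction (sym eq) (ℕ.<⇒≢ (mono b∈ a∈ b<a))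

  monotone-reflects : ∀ {a b} → a ∈ w → b ∈ w → f a < f b → a < b
  monotone-reflects {a} {b} a∈ b∈ fa<fb with ℕ.<-cmp a b
  ... | tri< a<b _ _  = a<b
  ... | tri≈ _ refl _ = contradiction fa<fb (ℕ.<-irrefl refl)
  ... | tri> _ _ b<a  = contradiction fa<fb (ℕ.<-asym (mono b∈ a∈ b<a))

monotoneOn-⊆ : ∀ {u w f} → (∀ {a} → a ∈ u → a ∈ w) → StrictlyMonotoneOn w f → StrictlyMonotoneOn u f
monotoneOn-⊆ ⊆ mono a∈ b∈ = mono (⊆ a∈) (⊆ b∈)

-- The rank of a letter counted by value instead of by position; it depends on `w` only as a
-- multiset.
relabel : Word → ℕ → ℕ
relabel w a = suc (length (filter (_<? a) w))

relabel-mono : ∀ w → StrictlyMonotoneOn w (relabel w)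
relabel-mono w {a} {b} a∈ b∈ a<b = s≤s (begin-strict
  length (filter (_<? a) w)
    ≡⟨ cong length (filter-cong _ _ w λ _ → mk⇔ (λ x<a → ℕ.<-trans x<a a<b , x<a) proj₂) ⟩
  length (filter (λ x → (x <? b) ×-dec (x <? a)) w)
                                                ≡⟨ cong length (filter-filter (_<? b) (_<? a) w) ⟨
  length (filter (_<? a) (filter (_<? b) w))
    -- The letter `a` itself is counted below `b` but not below `a`, whence strictness.
    <⟨ filter-notAll (_<? a) _ (lose (∈-filter⁺ (_<? b) a∈ a<b) (ℕ.<-irrefl refl)) ⟩
  length (filter (_<? b) w)                     ∎)
  where
  open ℕ.≤-Reasoning

relabel-↭ : ∀ {u v} → u ↭ v → ∀ a → relabel u a ≡ relabel v a
relabel-↭ u↭v a = cong suc (↭-length (filter-↭ (_<? a) u↭v))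

unique-lookup : ∀ {w : Word} → Unique w → ∀ {i j} → lookup w i ≡ lookup w j → i ≡ j
unique-lookup {x ∷ w} (_ ∷ _)  {Fin.zero}  {Fin.zero}  eq = refl
unique-lookup {x ∷ w} (x∉ ∷ _) {Fin.zero}  {Fin.suc j} eq =
  contradiction (subst (_∈ w) (sym eq) (∈-lookup j)) (All¬⇒¬Any x∉)
unique-lookup {x ∷ w} (x∉ ∷ _) {Fin.suc i} {Fin.zero}  eq =
  contradiction (subst (_∈ w) eq (∈-lookup i)) (All¬⇒¬Any x∉)
unique-lookup {x ∷ w} (_ ∷ w!) {Fin.suc i} {Fin.suc j} eq = cong Fin.suc (unique-lookup w! eq)

-- Without repetitions the tie-breaking clause of `Before` never applies. From here on `st` is
-- handled as a `map`, and facts about `map` carry over to it.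
st-unique : ∀ {w} → Unique w → st w ≡ map (relabel w) w
st-unique {w} w! = begin
  tabulate (rank w)                       ≡⟨ tabulate-cong rank-relabel ⟩
  tabulate (relabel w ∘ lookup w)         ≡⟨ map-tabulate (lookup w) (relabel w) ⟨
  map (relabel w) (tabulate (lookup w))   ≡⟨ cong (map (relabel w)) (tabulate-lookup w) ⟩
  map (relabel w) w                       ∎
  where
  open ≡-Reasoning
  before⇔< : ∀ i j → Before w j i ⇔ (lookup w j < lookup w i)
  before⇔< i j = mk⇔
    (λ { (inj₁ lt) → lt ; (inj₂ (eq , lt)) → contradiction (cong Fin.toℕ (unique-lookup w! eq)) (ℕ.<⇒≢ lt) })
    inj₁
  rank-relabel : ∀ i → rank w i ≡ relabel w (lookup w i)
  rank-relabel i = cong suc (begin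
    length (filter (λ j → before? w j i) (allFin (length w)))
      ≡⟨ cong length (filter-cong _ _ (allFin (length w)) (λ {j} _ → before⇔< i j)) ⟩
    length (filter ((_<? lookup w i) ∘ lookup w) (allFin (length w)))
      ≡⟨ length-map (lookup w) (filter ((_<? lookup w i) ∘ lookup w) (allFin (length w))) ⟨
    length (map (lookup w) (filter ((_<? lookup w i) ∘ lookup w) (allFin (length w))))
      ≡⟨ cong length (filter-map (_<? lookup w i) (lookup w) (allFin (length w))) ⟨
    length (filter (_<? lookup w i) (map (lookup w) (allFin (length w))))
      ≡⟨ cong (length ∘ filter (_<? lookup w i)) (trans (map-tabulate (λ j → j) (lookup w)) (tabulate-lookup w)) ⟩
    length (filter (_<? lookup w i) w) ∎)

-- An increasing `f` preserves the number of letters smaller than a given one.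
st-map : ∀ {w f} → Unique w → StrictlyMonotoneOn w f → st (map f w) ≡ st w
st-map {w} {f} w! mono = begin
  st (map f w)                          ≡⟨ st-unique (unique-map (monotone-injective mono) w!) ⟩
  map (relabel (map f w)) (map f w)     ≡⟨ map-∘ w ⟨
  map (relabel (map f w) ∘ f) w         ≡⟨ map-cong-local (All.tabulate relabel-f) ⟩
  map (relabel w) w                     ≡⟨ st-unique w! ⟨
  st w                                  ∎
  where
  open ≡-Reasoning
  relabel-f : ∀ {a} → a ∈ w → relabel (map f w) (f a) ≡ relabel w a
  relabel-f {a} a∈ = cong suc (begin
    length (filter (_<? f a) (map f w))           ≡⟨ cong length (filter-map (_<? f a) f w) ⟩
    length (map f (filter ((_<? f a) ∘ f) w))     ≡⟨ length-map f (filter ((_<? f a) ∘ f) w) ⟩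
    length (filter ((_<? f a) ∘ f) w)
      ≡⟨ cong length (filter-cong _ _ w λ b∈ → mk⇔ (monotone-reflects mono b∈ a∈) (mono b∈ a∈)) ⟩
    length (filter (_<? a) w)                     ∎)

∈-take : ∀ {X : Set} p {xs : List X} {x} → x ∈ take p xs → x ∈ xs
∈-take (suc p) {_ ∷ _} (here eq)  = here eq
∈-take (suc p) {_ ∷ _} (there x∈) = there (∈-take p x∈)

∈-drop : ∀ {X : Set} p {xs : List X} {x} → x ∈ drop p xs → x ∈ xs
∈-drop zero    x∈ = x∈
∈-drop (suc p) {_ ∷ _} x∈ = there (∈-drop p x∈)

-- `take` commutes with `map`, so a prefix of `st w` is an increasing image of the same prefix of
-- `w`. Suffixes behave alike.
st-take : ∀ p w → Unique w → st (take p (st w)) ≡ st (take p w)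
st-take p w w! rewrite st-unique w! | take-map {f = relabel w} p w =
  st-map (Unique.take⁺ p w!) (monotoneOn-⊆ (∈-take p) (relabel-mono w))

st-drop : ∀ p w → Unique w → st (drop p (st w)) ≡ st (drop p w)
st-drop p w w! rewrite st-unique w! | drop-map {f = relabel w} p w =
  st-map (Unique.drop⁺ p w!) (monotoneOn-⊆ (∈-drop p) (relabel-mono w))

drop-take-+ : ∀ {X : Set} p q (xs : List X) → drop p (take (p + q) xs) ≡ take q (drop p xs)
drop-take-+ zero    q       xs       = refl
drop-take-+ (suc p) zero    []       = refl
drop-take-+ (suc p) (suc q) []       = refl
drop-take-+ (suc p) q       (x ∷ xs) = drop-take-+ p q xs

st-take-take : ∀ p q w → Unique w → st (take p (st (take (p + q) w))) ≡ st (take p w)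
st-take-take p q w w!
  rewrite st-take p (take (p + q) w) (Unique.take⁺ (p + q) w!)
        | take-take p (p + q) w | ℕ.m≤n⇒m⊓n≡m (ℕ.m≤m+n p q) = refl

st-drop-take : ∀ p q w → Unique w → st (drop p (st (take (p + q) w))) ≡ st (take q (drop p w))
st-drop-take p q w w! rewrite st-drop p (take (p + q) w) (Unique.take⁺ (p + q) w!) | drop-take-+ p q w = refl

st-drop-drop : ∀ p q w → st (drop (p + q) w) ≡ st (drop q (drop p w))
st-drop-drop p q w rewrite drop-drop p q w = refl

-- Restriction to an interval of letters

between? : ∀ a b → Decidable [ a ‥ b ]
between? a b k = (a ≤? k) ×-dec (k ≤? b)

restrict-unique : ∀ {w} a b → Unique w → Unique (w ∣[ a ‥ b ])
restrict-unique a b = Unique.filter⁺ (between? a b)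

restrict-restrict : ∀ w {a b c d} → a ≤ c → d ≤ b → (w ∣[ a ‥ b ]) ∣[ c ‥ d ] ≡ w ∣[ c ‥ d ]
restrict-restrict w {a} {b} {c} {d} a≤c d≤b = trans (filter-filter (between? a b) (between? c d) w)
  (filter-cong _ _ w λ _ → mk⇔ proj₂ λ (c≤k , k≤d) → (ℕ.≤-trans a≤c c≤k , ℕ.≤-trans k≤d d≤b) , c≤k , k≤d)

module _ {w : Word} (w-perm : IsPermutation w) where

  restrict-↭ : ∀ a m → a + m ≤ length w → interval a m ↭ w ∣[ suc a ‥ a + m ]
  restrict-↭ a m a+m≤n = unique-set⇒↭ (interval-unique a m) (restrict-unique _ _ (permutation-unique w-perm)) (mk⇔
    (λ k∈ → let (lo , hi) = Equivalence.to ∈-interval k∈ in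
      ∈-filter⁺ (between? _ _) (proj₂ w-perm (ℕ.≤-trans (s≤s z≤n) lo , ℕ.≤-trans hi a+m≤n)) (lo , hi))
    (λ k∈ → Equivalence.from ∈-interval (proj₂ (∈-filter⁻ (between? (suc a) (a + m)) {xs = w} k∈))))

  length-restrict : ∀ a m → a + m ≤ length w → length (w ∣[ suc a ‥ a + m ]) ≡ m
  length-restrict a m a+m≤n = trans (sym (↭-length (restrict-↭ a m a+m≤n))) (length-applyUpTo _ m)

  -- The letters of the restricted word below `suc (a + k)` are exactly a+1, ..., a+k, each
  -- occurring once. Standardizing a restriction is therefore a shift of letters by `a`.
  relabel-restrict : ∀ a m → a + m ≤ length w → ∀ {k} → k < m →
                     relabel (w ∣[ suc a ‥ a + m ]) (suc (a + k)) ≡ suc k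
  relabel-restrict a m a+m≤n {k} k<m = cong suc (begin
    length (filter (_<? suc (a + k)) (w ∣[ suc a ‥ a + m ]))
      ≡⟨ cong length (filter-filter (between? (suc a) (a + m)) (_<? suc (a + k)) w) ⟩
    length (filter (λ x → between? (suc a) (a + m) x ×-dec (x <? suc (a + k))) w)
      ≡⟨ cong length (filter-cong _ _ w λ _ → mk⇔
           (λ ((lo , _) , hi) → lo , ℕ.≤-pred hi)
           (λ (lo , hi) → (lo , ℕ.≤-trans hi a+k≤a+m) , s≤s hi)) ⟩
    length (w ∣[ suc a ‥ a + k ])
      ≡⟨ length-restrict a k (ℕ.≤-trans a+k≤a+m a+m≤n) ⟩
    k                                                          ∎)
    where
    open ≡-Reasoning
    a+k≤a+m : a + k ≤ a + m
    a+k≤a+m = ℕ.+-monoʳ-≤ a (ℕ.<⇒≤ k<m)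

  restrict-all : w ∣[ 1 ‥ length w ] ≡ w
  restrict-all = filter-all (between? 1 (length w)) (All.tabulate (proj₁ w-perm))

  st-permutation : st w ≡ w
  st-permutation = begin
    st w                ≡⟨ st-unique (permutation-unique w-perm) ⟩
    map (relabel w) w   ≡⟨ map-id-local (All.tabulate fixed) ⟩
    w                   ∎
    where
    open ≡-Reasoning
    fixed : ∀ {k} → k ∈ w → relabel w k ≡ k
    fixed {k} k∈ with proj₁ w-perm k∈
    ... | s≤s {n = j} _ , j< =
      trans (cong (λ v → relabel v k) (sym restrict-all)) (relabel-restrict 0 (length w) ℕ.≤-refl j<)

  -- By the shift just computed, the letters c+1, ..., c+d of the standardized word come from a+c+1,
  -- ..., a+c+d. This is what makes iterated coproducts comparable.
  st-restrict-restrict : ∀ a m c d → a + m ≤ length w → c + d ≤ m →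
    st (st (w ∣[ suc a ‥ a + m ]) ∣[ suc c ‥ c + d ]) ≡ st (w ∣[ suc (a + c) ‥ a + c + d ])
  st-restrict-restrict a m c d a+m≤n c+d≤m = begin
    st (st v ∣[ suc c ‥ c + d ])
      ≡⟨ cong (λ u → st (u ∣[ suc c ‥ c + d ])) (st-unique v!) ⟩
    st (map (relabel v) v ∣[ suc c ‥ c + d ])
      ≡⟨ cong st (filter-map (between? (suc c) (c + d)) (relabel v) v) ⟩
    st (map (relabel v) (filter (between? (suc c) (c + d) ∘ relabel v) v))
      ≡⟨ cong (st ∘ map (relabel v)) (filter-cong _ (between? (suc (a + c)) (a + c + d)) v same) ⟩
    st (map (relabel v) (v ∣[ suc (a + c) ‥ a + c + d ]))
      ≡⟨ st-map (restrict-unique _ _ v!) (monotoneOn-⊆ (proj₁ ∘ ∈-filter⁻ (between? _ _)) (relabel-mono v)) ⟩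
    st (v ∣[ suc (a + c) ‥ a + c + d ])
      ≡⟨ cong st (restrict-restrict w (s≤s (ℕ.m≤m+n a c)) (subst (_≤ a + m) (sym (ℕ.+-assoc a c d)) (ℕ.+-monoʳ-≤ a c+d≤m))) ⟩
    st (w ∣[ suc (a + c) ‥ a + c + d ])                 ∎
    where
    open ≡-Reasoning
    v : Word
    v = w ∣[ suc a ‥ a + m ]
    v! : Unique v
    v! = restrict-unique _ _ (permutation-unique w-perm)
    same : ∀ {k} → k ∈ v → [ suc c ‥ c + d ] (relabel v k) ⇔ [ suc (a + c) ‥ a + c + d ] k
    same k∈ with ∈-applyUpTo⁻ _ (∈-resp-↭ (↭-sym (restrict-↭ a m a+m≤n)) k∈)
    ... | j , j<m , refl rewrite relabel-restrict a m a+m≤n j<m | ℕ.+-assoc a c d | sym (ℕ.+-suc a j) = mk⇔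
      (λ (lo , hi) → subst (suc (a + c) ≤_) (sym (ℕ.+-suc a j)) (s≤s (ℕ.+-monoʳ-≤ a (ℕ.≤-pred lo))) ,
                   ℕ.+-monoʳ-≤ a hi)
      (λ (lo , hi) → s≤s (ℕ.+-cancelˡ-≤ a _ _ (ℕ.≤-pred (subst (suc (a + c) ≤_) (ℕ.+-suc a j) lo))) ,
                   ℕ.+-cancelˡ-≤ a _ _ hi)

-- Adjacent swaps and Knuth moves

-- Out of range the list is left alone, so `swapAt i` is an involution on all lists and is its own
-- inverse in the bijection of terms.
swapAt : {X : Set} → ℕ → List X → List X
swapAt zero    (x ∷ y ∷ xs) = y ∷ x ∷ xs
swapAt zero    xs           = xs
swapAt (suc i) []           = []
swapAt (suc i) (x ∷ xs)     = x ∷ swapAt i xs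

module _ {X : Set} where

  swapAt-involutive : ∀ i (xs : List X) → swapAt i (swapAt i xs) ≡ xs
  swapAt-involutive zero    []           = refl
  swapAt-involutive zero    (x ∷ [])     = refl
  swapAt-involutive zero    (x ∷ y ∷ xs) = refl
  swapAt-involutive (suc i) []           = refl
  swapAt-involutive (suc i) (x ∷ xs)     = cong (x ∷_) (swapAt-involutive i xs)

  swapAt-injective : ∀ i {xs ys : List X} → swapAt i xs ≡ swapAt i ys → xs ≡ ys
  swapAt-injective i {xs} {ys} eq =
    trans (sym (swapAt-involutive i xs)) (trans (cong (swapAt i) eq) (swapAt-involutive i ys))

  swapAt-↭ : ∀ i (xs : List X) → swapAt i xs ↭ xs
  swapAt-↭ zero    []           = ↭-refl
  swapAt-↭ zero    (x ∷ [])     = ↭-refl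
  swapAt-↭ zero    (x ∷ y ∷ xs) = swap y x ↭-refl
  swapAt-↭ (suc i) []           = ↭-refl
  swapAt-↭ (suc i) (x ∷ xs)     = prep x (swapAt-↭ i xs)

  swapAt-map : ∀ {Y : Set} (f : X → Y) i xs → swapAt i (map f xs) ≡ map f (swapAt i xs)
  swapAt-map f zero    []           = refl
  swapAt-map f zero    (x ∷ [])     = refl
  swapAt-map f zero    (x ∷ y ∷ xs) = refl
  swapAt-map f (suc i) []           = refl
  swapAt-map f (suc i) (x ∷ xs)     = cong (f x ∷_) (swapAt-map f i xs)

  -- The bound places both exchanged positions before the cut; an exchange across the cut would not
  -- act on the prefix.
  take-swapAt : ∀ {i p} → suc i < p → (xs : List X) → take p (swapAt i xs) ≡ swapAt i (take p xs)
  take-swapAt {i}     {suc zero}    (s≤s ()) xs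
  take-swapAt {zero}  {suc (suc p)} _        []           = refl
  take-swapAt {zero}  {suc (suc p)} _        (x ∷ [])     = refl
  take-swapAt {zero}  {suc (suc p)} _        (x ∷ y ∷ xs) = refl
  take-swapAt {suc i} {suc (suc p)} _        []           = refl
  take-swapAt {suc i} {suc (suc p)} (s≤s lt) (x ∷ xs)     = cong (x ∷_) (take-swapAt lt xs)

  drop-swapAt : ∀ {i p} → suc i < p → (xs : List X) → drop p (swapAt i xs) ≡ drop p xs
  drop-swapAt {i}     {suc zero}    (s≤s ()) xs
  drop-swapAt {zero}  {suc (suc p)} _        []           = refl
  drop-swapAt {zero}  {suc (suc p)} _        (x ∷ [])     = refl
  drop-swapAt {zero}  {suc (suc p)} _        (x ∷ y ∷ xs) = refl
  drop-swapAt {suc i} {suc (suc p)} _        []           = refl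
  drop-swapAt {suc i} {suc (suc p)} (s≤s lt) (x ∷ xs)     = drop-swapAt lt xs

  take-swapAt-+ : ∀ p i (xs : List X) → take p (swapAt (p + i) xs) ≡ take p xs
  take-swapAt-+ zero    i xs       = refl
  take-swapAt-+ (suc p) i []       = refl
  take-swapAt-+ (suc p) i (x ∷ xs) = cong (x ∷_) (take-swapAt-+ p i xs)

  drop-swapAt-+ : ∀ p i (xs : List X) → drop p (swapAt (p + i) xs) ≡ swapAt i (drop p xs)
  drop-swapAt-+ zero    i       xs       = refl
  drop-swapAt-+ (suc p) zero    []       = refl
  drop-swapAt-+ (suc p) (suc i) []       = refl
  drop-swapAt-+ (suc p) i       (x ∷ xs) = drop-swapAt-+ p i xs

st-swapAt : ∀ i {w} → Unique w → st (swapAt i w) ≡ swapAt i (st w)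
st-swapAt i {w} w! = begin
  st (swapAt i w)                             ≡⟨ st-unique (unique-resp-↭ (↭-sym (swapAt-↭ i w)) w!) ⟩
  map (relabel (swapAt i w)) (swapAt i w)     ≡⟨ map-cong (relabel-↭ (swapAt-↭ i w)) (swapAt i w) ⟩
  map (relabel w) (swapAt i w)                ≡⟨ swapAt-map (relabel w) i w ⟨
  swapAt i (map (relabel w) w)                ≡⟨ cong (swapAt i) (st-unique w!) ⟨
  swapAt i (st w)                             ∎
  where open ≡-Reasoning

Convex : Pred ℕ 0ℓ → Set
Convex P = ∀ {x y z} → x < y → y < z → P x → P z → P y

interval-convex : ∀ a b → Convex [ a ‥ b ]
interval-convex a b x<y y<z (a≤x , _) (_ , z≤b) = ℕ.≤-trans a≤x (ℕ.<⇒≤ x<y) , ℕ.≤-trans (ℕ.<⇒≤ y<z) z≤b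

-- At i w says that the letters of w in positions i, i + 1 (counted from 0)
-- may be swapped.
record Moves (_∼_ : Rel Word 0ℓ) : Set₁ where
  field
    At          : ℕ → Pred Word 0ℓ
    At⇒∼        : ∀ {i w} → At i w → w ∼ swapAt i w
    ∼⇒At        : ∀ {u v} → u ∼ v → ∃ λ i → At i u × v ≡ swapAt i u
    At-length   : ∀ {i w} → At i w → suc i < length w
    At-++⁺      : ∀ {i u} v → At i u → At i (u ++ v)
    At-map⁺     : ∀ {i w f} → StrictlyMonotoneOn w f → At i w → At i (map f w)
    At-map⁻     : ∀ {i w f} → StrictlyMonotoneOn w f → At i (map f w) → At i w
    -- If a swapped letter is erased the two filtered words coincide. Otherwise the pair stays
    -- adjacent, possibly at an earlier position `j`.
    At-filter   : ∀ {i w} {P : Pred ℕ 0ℓ} (P? : Decidable P) → Convex P → At i w →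
                  filter P? (swapAt i w) ≡ filter P? w ⊎
                  (∃ λ j → At j (filter P? w) × filter P? (swapAt i w) ≡ swapAt j (filter P? w))

  ∼⇒↭ : ∀ {u v} → u ∼ v → u ↭ v
  ∼⇒↭ u∼v with ∼⇒At u∼v
  ... | i , _ , refl = ↭-sym (swapAt-↭ i _)

  -- Appending the removed suffix keeps a move legal. This lifts moves from the left factor to a
  -- term of the product.
  At-take⁻ : ∀ {i} p {w} → At i (take p w) → At i w
  At-take⁻ {i} p {w} = subst (At i) (take++drop≡id p w) ∘ At-++⁺ (drop p w)

  At-st⁺ : ∀ {i w} → Unique w → At i w → At i (st w)
  At-st⁺ {i} {w} w! = subst (At i) (sym (st-unique w!)) ∘ At-map⁺ (relabel-mono w)

  At-st⁻ : ∀ {i w} → Unique w → At i (st w) → At i w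
  At-st⁻ {i} {w} w! = At-map⁻ (relabel-mono w) ∘ subst (At i) (st-unique w!)

-- The index is the position of the exchanged pair: in `sk1` the witness `y` follows the pair, in
-- `sk2` it precedes it, hence the 1. One orientation suffices, since the equivalence closure
-- supplies the other.
data KnuthAt : ℕ → Pred Word 0ℓ where
  sk1  : ∀ {x y z t} → x < y → y < z → KnuthAt 0 (x ∷ z ∷ y ∷ t)
  sk2  : ∀ {x y z t} → x < y → y < z → KnuthAt 1 (y ∷ x ∷ z ∷ t)
  skip : ∀ {i w} x → KnuthAt i w → KnuthAt (suc i) (x ∷ w)

∼K-∷ : ∀ x {u v} → u ∼K v → x ∷ u ∼K x ∷ v
∼K-∷ x (SK1 s t p q) = SK1 (x ∷ s) t p q
∼K-∷ x (SK2 s t p q) = SK2 (x ∷ s) t p q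

knuthAt⇒∼K : ∀ {i w} → KnuthAt i w → w ∼K swapAt i w
knuthAt⇒∼K (sk1 p q)  = SK1 [] _ p q
knuthAt⇒∼K (sk2 p q)  = SK2 [] _ p q
knuthAt⇒∼K (skip x k) = ∼K-∷ x (knuthAt⇒∼K k)

∼K⇒knuthAt : ∀ {u v} → u ∼K v → ∃ λ i → KnuthAt i u × v ≡ swapAt i u
∼K⇒knuthAt (SK1 [] t p q) = 0 , sk1 p q , refl
∼K⇒knuthAt (SK2 [] t p q) = 1 , sk2 p q , refl
∼K⇒knuthAt (SK1 (x ∷ s) t p q) with ∼K⇒knuthAt (SK1 s t p q)
... | i , k , eq = suc i , skip x k , cong (x ∷_) eq
∼K⇒knuthAt (SK2 (x ∷ s) t p q) with ∼K⇒knuthAt (SK2 s t p q)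
... | i , k , eq = suc i , skip x k , cong (x ∷_) eq

knuthAt-length : ∀ {i w} → KnuthAt i w → suc i < length w
knuthAt-length (sk1 _ _)  = s≤s (s≤s z≤n)
knuthAt-length (sk2 _ _)  = s≤s (s≤s (s≤s z≤n))
knuthAt-length (skip _ k) = s≤s (knuthAt-length k)

knuthAt-++⁺ : ∀ {i u} v → KnuthAt i u → KnuthAt i (u ++ v)
knuthAt-++⁺ v (sk1 p q)  = sk1 p q
knuthAt-++⁺ v (sk2 p q)  = sk2 p q
knuthAt-++⁺ v (skip x k) = skip x (knuthAt-++⁺ v k)

-- Knuth moves may take place anywhere in a word. This makes J_K a left ideal too.
knuthAt-drop⁻ : ∀ {i w} p → KnuthAt i (drop p w) → KnuthAt (p + i) w
knuthAt-drop⁻ zero k = k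
knuthAt-drop⁻ {w = x ∷ w} (suc p) k = skip x (knuthAt-drop⁻ p k)

pattern 1st = here refl
pattern 2nd = there (here refl)
pattern 3rd = there (there (here refl))

knuthAt-map⁺ : ∀ {i w f} → StrictlyMonotoneOn w f → KnuthAt i w → KnuthAt i (map f w)
knuthAt-map⁺ mono (sk1 p q)  = sk1 (mono 1st 3rd p) (mono 3rd 2nd q)
knuthAt-map⁺ mono (sk2 p q)  = sk2 (mono 2nd 1st p) (mono 1st 3rd q)
knuthAt-map⁺ mono (skip x k) = skip _ (knuthAt-map⁺ (monotoneOn-⊆ there mono) k)

knuthAt-map⁻ : ∀ {i w f} → StrictlyMonotoneOn w f → KnuthAt i (map f w) → KnuthAt i w
knuthAt-map⁻ {w = _ ∷ _ ∷ _ ∷ _} {f} mono (sk1 p q) =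
  sk1 (monotone-reflects {f = f} mono 1st 3rd p) (monotone-reflects {f = f} mono 3rd 2nd q)
knuthAt-map⁻ {w = _ ∷ _ ∷ _ ∷ _} {f} mono (sk2 p q) =
  sk2 (monotone-reflects {f = f} mono 2nd 1st p) (monotone-reflects {f = f} mono 1st 3rd q)
knuthAt-map⁻ {w = _ ∷ _} mono (skip _ k) = skip _ (knuthAt-map⁻ (monotoneOn-⊆ there mono) k)

module _ {P : Pred ℕ 0ℓ} (P? : Decidable P) where

  filter-∷ : ∀ x xs → filter P? (x ∷ xs) ≡ filter P? (x ∷ []) ++ filter P? xs
  filter-∷ x = filter-++ P? (x ∷ [])

  knuthAt-filter : ∀ {i w} → Convex P → KnuthAt i w →
    filter P? (swapAt i w) ≡ filter P? w ⊎
    (∃ λ j → KnuthAt j (filter P? w) × filter P? (swapAt i w) ≡ swapAt j (filter P? w))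
  knuthAt-filter c (sk1 {x} {y} {z} {t} x<y y<z)
    -- Splitting off single letters makes both filtered words depend on the same three decisions,
    -- whatever the order of the letters.
    rewrite filter-∷ x (z ∷ y ∷ t) | filter-∷ z (x ∷ y ∷ t) | filter-∷ x (y ∷ t) | filter-∷ z (y ∷ t) | filter-∷ y t
    with P? x | P? z | P? y
  ... | no _   | no _   | _     = inj₁ refl
  ... | no _   | yes _  | _     = inj₁ refl
  ... | yes _  | no _   | _     = inj₁ refl
  ... | yes px | yes pz | no ¬p = contradiction (c x<y y<z px pz) ¬p
  ... | yes _  | yes _  | yes _ = inj₂ (0 , sk1 x<y y<z , refl)
  knuthAt-filter c (sk2 {x} {y} {z} {t} x<y y<z)
    rewrite filter-∷ y (x ∷ z ∷ t) | filter-∷ y (z ∷ x ∷ t) | filter-∷ x (z ∷ t) | filter-∷ z (x ∷ t) | filter-∷ x t | filter-∷ z t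
    with P? y | P? x | P? z
  ... | _     | no _   | no _   = inj₁ refl
  ... | _     | no _   | yes _  = inj₁ refl
  ... | _     | yes _  | no _   = inj₁ refl
  ... | no ¬p | yes px | yes pz = contradiction (c x<y y<z px pz) ¬p
  ... | yes _ | yes _  | yes _  = inj₂ (1 , sk2 x<y y<z , refl)
  knuthAt-filter c (skip x k) with P? x | knuthAt-filter c k
  ... | no _  | r                 = r
  ... | yes _ | inj₁ eq           = inj₁ (cong (x ∷_) eq)
  ... | yes _ | inj₂ (j , l , eq) = inj₂ (suc j , skip x l , cong (x ∷_) eq)

knuthMoves : Moves _∼K_
knuthMoves = record
  { At        = KnuthAt
  ; At⇒∼      = knuthAt⇒∼K
  ; ∼⇒At      = ∼K⇒knuthAt
  ; At-length = knuthAt-length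
  ; At-++⁺    = knuthAt-++⁺
  ; At-map⁺   = knuthAt-map⁺
  ; At-map⁻   = knuthAt-map⁻
  ; At-filter = λ P? → knuthAt-filter P?
  }

-- `skip` wraps Knuth moves only, so `sk3` stays tied to position 0.
data ShiftedKnuthAt : ℕ → Pred Word 0ℓ where
  knuth : ∀ {i w} → KnuthAt i w → ShiftedKnuthAt i w
  sk3   : ∀ {x y t} → ShiftedKnuthAt 0 (x ∷ y ∷ t)

shiftedKnuthMoves : Moves _∼SK_
shiftedKnuthMoves = record
  { At        = ShiftedKnuthAt
  ; At⇒∼      = λ { (knuth k) → knuth (knuthAt⇒∼K k) ; sk3 → SK3 _ _ _ }
  ; ∼⇒At      = λ { (knuth m) → let (i , k , eq) = ∼K⇒knuthAt m in i , knuth k , eq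
                  ; (SK3 x y t) → 0 , sk3 , refl }
  ; At-length = λ { (knuth k) → knuthAt-length k ; sk3 → s≤s (s≤s z≤n) }
  ; At-++⁺    = λ { v (knuth k) → knuth (knuthAt-++⁺ v k) ; v sk3 → sk3 }
  ; At-map⁺   = λ { mono (knuth k) → knuth (knuthAt-map⁺ mono k) ; mono sk3 → sk3 }
  ; At-map⁻   = map⁻
  ; At-filter = restrict
  }
  where
  map⁻ : ∀ {i w f} → StrictlyMonotoneOn w f → ShiftedKnuthAt i (map f w) → ShiftedKnuthAt i w
  map⁻ {w = _ ∷ _ ∷ _} mono sk3 = sk3
  map⁻ mono (knuth k) = knuth (knuthAt-map⁻ mono k)
  restrict : ∀ {i w} {P : Pred ℕ 0ℓ} (P? : Decidable P) → Convex P → ShiftedKnuthAt i w →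
    filter P? (swapAt i w) ≡ filter P? w ⊎
    (∃ λ j → ShiftedKnuthAt j (filter P? w) × filter P? (swapAt i w) ≡ swapAt j (filter P? w))
  restrict P? c (knuth k) with knuthAt-filter P? c k
  ... | inj₁ eq           = inj₁ eq
  ... | inj₂ (j , l , eq) = inj₂ (j , knuth l , eq)
  restrict P? c (sk3 {x} {y} {t})
    rewrite filter-∷ P? x (y ∷ t) | filter-∷ P? y (x ∷ t) | filter-∷ P? x t | filter-∷ P? y t
    with P? x | P? y
  ... | no _  | no _  = inj₁ refl
  ... | no _  | yes _ = inj₁ refl
  ... | yes _ | no _  = inj₁ refl
  -- Nothing precedes the pair, so its surviving letters are again the first two.
  ... | yes _ | yes _ = inj₂ (0 , sk3 , refl)

-- Presented abelian groups

_∋_≈_ : (A : Ab) → ∣ A ∣ → ∣ A ∣ → Set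
A ∋ x ≈ y = AbelianGroup._≈_ A x y

module _ (A B : Ab) {φ : ∣ A ∣ → ∣ B ∣} where
  private
    module A = AbelianGroup A
    module B = AbelianGroup B
    module P = AbelianGroupProperties B

  module _ (φ-cong : ∀ {x y} → x A.≈ y → φ x B.≈ φ y) (φ-∙ : ∀ x y → φ (x A.∙ y) B.≈ φ x B.∙ φ y) where

    additive-ε : φ A.ε B.≈ B.ε
    additive-ε = P.identityʳ-unique (φ A.ε) (φ A.ε) (B.trans (B.sym (φ-∙ A.ε A.ε)) (φ-cong (A.identityˡ A.ε)))

    additive-⁻¹ : ∀ x → φ (x A.⁻¹) B.≈ φ x B.⁻¹
    additive-⁻¹ x = P.inverseˡ-unique (φ (x A.⁻¹)) (φ x)
      (B.trans (B.sym (φ-∙ (x A.⁻¹) x)) (B.trans (φ-cong (A.inverseˡ x)) additive-ε))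

    additive-linear : IsLinear A B φ
    additive-linear = record
      { isMonoidHomomorphism = record
        { isMagmaHomomorphism = record { isRelHomomorphism = record { cong = φ-cong } ; homo = φ-∙ }
        ; ε-homo = additive-ε }
      ; ⁻¹-homo = additive-⁻¹ }

module _ (A : Ab) where
  private module A = AbelianGroup A
  open SetoidReasoning A.setoid

  ∑-cong : {X : Set} {f g : X → ∣ A ∣} (xs : List X) → (∀ {x} → x ∈ xs → f x A.≈ g x) →
           ∑ A (map f xs) A.≈ ∑ A (map g xs)
  ∑-cong []       f≈g = A.refl
  ∑-cong (x ∷ xs) f≈g = A.∙-cong (f≈g (here refl)) (∑-cong xs (f≈g ∘ there))

  ∑-map : {X Y : Set} {f : Y → ∣ A ∣} (g : X → Y) (xs : List X) → ∑ A (map f (map g xs)) A.≈ ∑ A (map (f ∘ g) xs)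
  ∑-map g []       = A.refl
  ∑-map g (x ∷ xs) = A.∙-congˡ (∑-map g xs)

  ∑-++ : ∀ xs ys → ∑ A (xs ++ ys) A.≈ ∑ A xs A.∙ ∑ A ys
  ∑-++ []       ys = A.sym (A.identityˡ _)
  ∑-++ (x ∷ xs) ys = A.trans (A.∙-congˡ (∑-++ xs ys)) (A.sym (A.assoc _ _ _))

  ∑-concatMap : {X Y : Set} {f : Y → ∣ A ∣} (g : X → List Y) (xs : List X) →
                ∑ A (map f (concatMap g xs)) A.≈ ∑ A (map (λ x → ∑ A (map f (g x))) xs)
  ∑-concatMap g [] = A.refl
  ∑-concatMap {f = f} g (x ∷ xs) = begin
    ∑ A (map f (g x ++ concatMap g xs))                    ≡⟨ cong (∑ A) (map-++ f (g x) _) ⟩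
    ∑ A (map f (g x) ++ map f (concatMap g xs))            ≈⟨ ∑-++ (map f (g x)) _ ⟩
    ∑ A (map f (g x)) A.∙ ∑ A (map f (concatMap g xs))     ≈⟨ A.∙-congˡ (∑-concatMap g xs) ⟩
    ∑ A (map f (g x)) A.∙ ∑ A (map (λ x → ∑ A (map f (g x))) xs) ∎

  ∑-↭ : {X : Set} {f : X → ∣ A ∣} {xs ys : List X} → xs ↭ ys → ∑ A (map f xs) A.≈ ∑ A (map f ys)
  ∑-↭ Perm.refl        = A.refl
  ∑-↭ (prep x p)       = A.∙-congˡ (∑-↭ p)
  ∑-↭ {f = f} {ys = _ ∷ _ ∷ ys} (swap x y p) = A.trans (A.∙-congˡ (A.∙-congˡ (∑-↭ p)))
    (CommutativeSemigroupProperties.x∙yz≈y∙xz A.commutativeSemigroup (f x) (f y) (∑ A (map f ys)))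
  ∑-↭ (Perm.trans p q) = A.trans (∑-↭ p) (∑-↭ q)

  -- The sum over i + j = n, with both parts passed to `F`; a coproduct indexed this way gives both
  -- sizes of each cut.
  antidiagonal : ℕ → (ℕ → ℕ → ∣ A ∣) → ∣ A ∣
  antidiagonal zero    F = F 0 0
  antidiagonal (suc n) F = F 0 (suc n) A.∙ antidiagonal n (F ∘ suc)

  antidiagonal-cong : ∀ n {F G} → (∀ i j → i + j ≡ n → F i j A.≈ G i j) → antidiagonal n F A.≈ antidiagonal n G
  antidiagonal-cong zero    F≈G = F≈G 0 0 refl
  antidiagonal-cong (suc n) F≈G =
    A.∙-cong (F≈G 0 (suc n) refl) (antidiagonal-cong n λ i j eq → F≈G (suc i) j (cong suc eq))

  antidiagonal-∙ : ∀ n F G → antidiagonal n (λ i j → F i j A.∙ G i j) A.≈ antidiagonal n F A.∙ antidiagonal n G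
  antidiagonal-∙ zero    F G = A.refl
  antidiagonal-∙ (suc n) F G = A.trans (A.∙-congˡ (antidiagonal-∙ n (F ∘ suc) (G ∘ suc)))
    (CommutativeSemigroupProperties.interchange A.commutativeSemigroup _ _ _ _)

  -- Both sides run over the triples i + j + k = n. The triples with i = 0 are collected into
  -- `antidiagonal (suc n) (F 0)`, and induction treats the others with `i` lowered by one.
  antidiagonal-assoc : ∀ n (F : ℕ → ℕ → ℕ → ∣ A ∣) →
    antidiagonal n (λ m k → antidiagonal m (λ i j → F i j k)) A.≈
    antidiagonal n (λ i m → antidiagonal m (λ j k → F i j k))
  antidiagonal-assoc zero    F = A.refl
  antidiagonal-assoc (suc n) F = begin
    F 0 0 (suc n) A.∙ antidiagonal n (λ m k → F 0 (suc m) k A.∙ antidiagonal m (λ i j → F (suc i) j k))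
      ≈⟨ A.∙-congˡ (antidiagonal-∙ n _ _) ⟩
    F 0 0 (suc n) A.∙ (antidiagonal n (λ m k → F 0 (suc m) k) A.∙ antidiagonal n (λ m k → antidiagonal m (λ i j → F (suc i) j k)))
      ≈⟨ A.assoc _ _ _ ⟨
    antidiagonal (suc n) (F 0) A.∙ antidiagonal n (λ m k → antidiagonal m (λ i j → F (suc i) j k))
      ≈⟨ A.∙-congˡ (antidiagonal-assoc n (F ∘ suc)) ⟩
    antidiagonal (suc n) (F 0) A.∙ antidiagonal n (λ i m → antidiagonal m (λ j k → F (suc i) j k)) ∎

  antidiagonal-zero : ∀ n {F} → (∀ i j → i + j ≡ n → F i j A.≈ A.ε) → antidiagonal n F A.≈ A.ε
  antidiagonal-zero zero    F≈0 = F≈0 0 0 refl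
  antidiagonal-zero (suc n) F≈0 = A.trans
    (A.∙-cong (F≈0 0 (suc n) refl) (antidiagonal-zero n λ i j eq → F≈0 (suc i) j (cong suc eq)))
    (A.identityˡ _)

  antidiagonal-first : ∀ n {F} → (∀ i j → suc i + j ≡ n → F (suc i) j A.≈ A.ε) → antidiagonal n F A.≈ F 0 n
  antidiagonal-first zero    F≈0 = A.refl
  antidiagonal-first (suc n) F≈0 = A.trans
    (A.∙-congˡ (antidiagonal-zero n λ i j eq → F≈0 i j (cong suc eq))) (A.identityʳ _)

  antidiagonal-last : ∀ n {F} → (∀ i j → i + suc j ≡ n → F i (suc j) A.≈ A.ε) → antidiagonal n F A.≈ F n 0
  antidiagonal-last zero    F≈0 = A.refl
  antidiagonal-last (suc n) F≈0 = A.trans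
    (A.∙-cong (F≈0 0 n refl) (antidiagonal-last n λ i j eq → F≈0 (suc i) j (cong suc eq))) (A.identityˡ _)

  ∑-antidiagonal : ∀ n {f : ℕ → ∣ A ∣} {F} → (∀ i j → i + j ≡ n → f i A.≈ F i j) →
                   ∑ A (map f (upTo (suc n))) A.≈ antidiagonal n F
  ∑-antidiagonal n {f} {F} eqs = subst (λ xs → ∑ A xs A.≈ antidiagonal n F) (sym (map-upTo f (suc n))) (go n f eqs)
    where
    go : ∀ n f {F} → (∀ i j → i + j ≡ n → f i A.≈ F i j) → ∑ A (applyUpTo f (suc n)) A.≈ antidiagonal n F
    go zero    f eqs = A.trans (A.identityʳ _) (eqs 0 0 refl)
    go (suc n) f eqs = A.∙-cong (eqs 0 (suc n) refl) (go n (f ∘ suc) λ i j eq → eqs (suc i) j (cong suc eq))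

-- Additivity on raw formal expressions, before any congruence on them is chosen. One function can
-- thus be used on ℤ𝔖 and on its quotients, which share their carrier.
record IsTermHom {G : Set} (A : Ab) (F : Term G → ∣ A ∣) : Set where
  private module A = AbelianGroup A
  field
    𝟘-homo : F 𝟘 A.≈ A.ε
    ⊕-homo : ∀ s t → F (s ⊕ t) A.≈ F s A.∙ F t
    ⊖-homo : ∀ t → F (⊖ t) A.≈ F t A.⁻¹

open IsTermHom

module _ {G : Set} (A : Ab) where
  private
    module A = AbelianGroup A
    module P = AbelianGroupProperties A

  termHom-ext : {F H : Term G → ∣ A ∣} → IsTermHom A F → IsTermHom A H →
                (∀ g → F (gen g) A.≈ H (gen g)) → ∀ t → F t A.≈ H t
  termHom-ext F-hom H-hom eq (gen g) = eq g
  termHom-ext F-hom H-hom eq 𝟘 = A.trans (𝟘-homo F-hom) (A.sym (𝟘-homo H-hom))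
  termHom-ext F-hom H-hom eq (s ⊕ t) = A.trans (⊕-homo F-hom s t) (A.trans
    (A.∙-cong (termHom-ext F-hom H-hom eq s) (termHom-ext F-hom H-hom eq t)) (A.sym (⊕-homo H-hom s t)))
  termHom-ext F-hom H-hom eq (⊖ t) = A.trans (⊖-homo F-hom t) (A.trans
    (A.⁻¹-cong (termHom-ext F-hom H-hom eq t)) (A.sym (⊖-homo H-hom t)))

  extend-hom : (f : G → ∣ A ∣) → IsTermHom A (extend A f)
  extend-hom f = record { 𝟘-homo = A.refl ; ⊕-homo = λ _ _ → A.refl ; ⊖-homo = λ _ → A.refl }

  zero-hom : IsTermHom {G} A (λ _ → A.ε)
  zero-hom = record { 𝟘-homo = A.refl ; ⊕-homo = λ _ _ → A.sym (A.identityˡ _) ; ⊖-homo = λ _ → A.sym P.ε⁻¹≈ε }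

  ∙-hom : {F H : Term G → ∣ A ∣} → IsTermHom A F → IsTermHom A H → IsTermHom A (λ t → F t A.∙ H t)
  ∙-hom {F} {H} F-hom H-hom = record
    { 𝟘-homo = A.trans (A.∙-cong (𝟘-homo F-hom) (𝟘-homo H-hom)) (A.identityˡ _)
    ; ⊕-homo = λ s t → A.trans (A.∙-cong (⊕-homo F-hom s t) (⊕-homo H-hom s t))
                               (CommutativeSemigroupProperties.interchange A.commutativeSemigroup _ _ _ _)
    ; ⊖-homo = λ t → A.trans (A.∙-cong (⊖-homo F-hom t) (⊖-homo H-hom t)) (P.⁻¹-∙-comm (F t) (H t)) }

  ⁻¹-hom : {F : Term G → ∣ A ∣} → IsTermHom A F → IsTermHom A (λ t → F t A.⁻¹)
  ⁻¹-hom {F} F-hom = record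
    { 𝟘-homo = A.trans (A.⁻¹-cong (𝟘-homo F-hom)) P.ε⁻¹≈ε
    ; ⊕-homo = λ s t → A.trans (A.⁻¹-cong (⊕-homo F-hom s t)) (A.sym (P.⁻¹-∙-comm (F s) (F t)))
    ; ⊖-homo = λ t → A.⁻¹-cong (⊖-homo F-hom t) }

  -- `F` is additive only modulo `R`, so `H` has to respect the congruence for the composite to be
  -- additive.
  ∘-hom : {G′ : Set} {R : Rel (Term G) 0ℓ} {F : Term G′ → Term G} {H : Term G → ∣ A ∣} →
          IsTermHom A H → (∀ {s t} → Congruence R s t → H s A.≈ H t) → IsTermHom (presented G R) F →
          IsTermHom A (H ∘ F)
  ∘-hom H-hom H-cong F-hom = record
    { 𝟘-homo = A.trans (H-cong (𝟘-homo F-hom)) (𝟘-homo H-hom)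
    ; ⊕-homo = λ s t → A.trans (H-cong (⊕-homo F-hom s t)) (⊕-homo H-hom _ _)
    ; ⊖-homo = λ t → A.trans (H-cong (⊖-homo F-hom t)) (⊖-homo H-hom _) }

  -- For maps such as `a ⊗ₑ_`, which build a new generator instead of recursing on the term: their
  -- values at zero and at negatives follow from well-definedness and additivity.
  additive-hom : {R : Rel (Term G) 0ℓ} {F : Term G → ∣ A ∣} →
                 (∀ {s t} → Congruence R s t → F s A.≈ F t) → (∀ s t → F (s ⊕ t) A.≈ F s A.∙ F t) → IsTermHom A F
  additive-hom {R} F-cong F-⊕ = record
    { 𝟘-homo = additive-ε (presented G R) A F-cong F-⊕
    ; ⊕-homo = F-⊕
    ; ⊖-homo = additive-⁻¹ (presented G R) A F-cong F-⊕ }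

  module _ {F : Term G → ∣ A ∣} (F-hom : IsTermHom A F) where

    -- The left-hand sum is ∑ (presented G R), for any R.
    termHom-∑ : {X : Set} {f : X → Term G} (xs : List X) →
                F (foldr _⊕_ 𝟘 (map f xs)) A.≈ ∑ A (map (F ∘ f) xs)
    termHom-∑ []       = 𝟘-homo F-hom
    termHom-∑ (x ∷ xs) = A.trans (⊕-homo F-hom _ _) (A.∙-congˡ (termHom-∑ xs))

    termHom-difference : ∀ {s t} → F s A.≈ F t → F (s ⊕ ⊖ t) A.≈ A.ε
    termHom-difference {s} {t} eq = A.trans (⊕-homo F-hom s (⊖ t)) (A.trans (A.∙-cong eq (⊖-homo F-hom t)) (A.inverseʳ _))

    termHom-difference⁻ : ∀ {s t} → F (s ⊕ ⊖ t) A.≈ A.ε → F s A.≈ F t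
    termHom-difference⁻ {s} {t} eq = P.∙-cancelʳ (F t A.⁻¹) (F s) (F t)
      (A.trans (A.trans (A.∙-congˡ (A.sym (⊖-homo F-hom t))) (A.sym (⊕-homo F-hom s (⊖ t)))) (A.trans eq (A.sym (A.inverseʳ _))))

    module _ {R : Rel (Term G) 0ℓ} (F-rel : ∀ {s t} → R s t → F s A.≈ F t) where

      -- Universal property of a presentation: only the defining relations are checked, and the
      -- group axioms are those of `A`.
      termHom-cong : ∀ {s t} → Congruence R s t → F s A.≈ F t
      termHom-cong (rel r)         = F-rel r
      termHom-cong reflexive       = A.refl
      termHom-cong (symmetric p)   = A.sym (termHom-cong p)
      termHom-cong (compose p q)   = A.trans (termHom-cong p) (termHom-cong q)
      termHom-cong (⊕-cong p q)    =
        A.trans (⊕-homo F-hom _ _) (A.trans (A.∙-cong (termHom-cong p) (termHom-cong q)) (A.sym (⊕-homo F-hom _ _)))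
      termHom-cong (⊖-cong p)      =
        A.trans (⊖-homo F-hom _) (A.trans (A.⁻¹-cong (termHom-cong p)) (A.sym (⊖-homo F-hom _)))
      termHom-cong (⊕-assoc s t u) = A.trans
        (A.trans (⊕-homo F-hom _ _) (A.∙-congʳ (⊕-homo F-hom _ _)))
        (A.trans (A.assoc _ _ _) (A.sym (A.trans (⊕-homo F-hom _ _) (A.∙-congˡ (⊕-homo F-hom _ _)))))
      termHom-cong (⊕-comm s t)    =
        A.trans (⊕-homo F-hom _ _) (A.trans (A.comm _ _) (A.sym (⊕-homo F-hom _ _)))
      termHom-cong (⊕-idˡ s)       =
        A.trans (⊕-homo F-hom _ _) (A.trans (A.∙-congʳ (𝟘-homo F-hom)) (A.identityˡ _))
      termHom-cong (⊖-invˡ s)      = A.trans (⊕-homo F-hom _ _)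
        (A.trans (A.∙-congʳ (⊖-homo F-hom _)) (A.trans (A.inverseˡ _) (A.sym (𝟘-homo F-hom))))

      termHom-span : {P : Pred (Term G) 0ℓ} → (∀ {t} → P t → F t A.≈ A.ε) →
                     ∀ {t} → Span (presented G R) P t → F t A.≈ A.ε
      termHom-span F-P (incl p)   = F-P p
      termHom-span F-P (resp e p) = A.trans (A.sym (termHom-cong e)) (termHom-span F-P p)
      termHom-span F-P zero       = 𝟘-homo F-hom
      termHom-span F-P (plus p q) = A.trans (⊕-homo F-hom _ _)
        (A.trans (A.∙-cong (termHom-span F-P p) (termHom-span F-P q)) (A.identityˡ _))
      termHom-span F-P (minus p)  = A.trans (⊖-homo F-hom _)
        (A.trans (A.⁻¹-cong (termHom-span F-P p)) P.ε⁻¹≈ε)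

id-hom : {G : Set} {R : Rel (Term G) 0ℓ} → IsTermHom (presented G R) (λ t → t)
id-hom = record { 𝟘-homo = reflexive ; ⊕-homo = λ _ _ → reflexive ; ⊖-homo = λ _ → reflexive }

-- Quotients and tensor products

module _ (A : Ab) {J : Pred ∣ A ∣ 0ℓ} (J-sub : IsSubgroup A J) where
  private
    module A = AbelianGroup A
    open IsSubgroup J-sub
    module P = AbelianGroupProperties A

  quotient-≈ : ∀ {x y} → x A.≈ y → quotient A J-sub ∋ x ≈ y
  quotient-≈ x≈y = resp-≈ (A.sym (A.trans (A.∙-congʳ x≈y) (A.inverseʳ _))) ε-closed

  x-ε≈x : ∀ {x} → x A.- A.ε A.≈ x
  x-ε≈x = A.trans (A.∙-congˡ P.ε⁻¹≈ε) (A.identityʳ _)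

  quotient-hom : {G : Set} {F : Term G → ∣ A ∣} → IsTermHom A F → IsTermHom (quotient A J-sub) F
  quotient-hom F-hom = record
    { 𝟘-homo = quotient-≈ (𝟘-homo F-hom)
    ; ⊕-homo = λ s t → quotient-≈ (⊕-homo F-hom s t)
    ; ⊖-homo = λ t → quotient-≈ (⊖-homo F-hom t) }

  -- Equality with `ε` in the quotient unfolds to membership of `x - ε`, not of `x`.
  ∈⇒quotient-ε : ∀ {x} → J x → quotient A J-sub ∋ x ≈ A.ε
  ∈⇒quotient-ε = resp-≈ (A.sym x-ε≈x)

  quotient-ε⇒∈ : ∀ {x} → quotient A J-sub ∋ x ≈ A.ε → J x
  quotient-ε⇒∈ = resp-≈ x-ε≈x

module _ (A B : Ab) where
  private
    module A = AbelianGroup A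
    module B = AbelianGroup B
    module T = AbelianGroup (A ⊗ B)

  ⊗-congˡ : ∀ {a b b′} → b B.≈ b′ → (a ⊗ₑ b) T.≈ (a ⊗ₑ b′)
  ⊗-congˡ eq = rel (⊗-cong A.refl eq)

  ⊗-congʳ : ∀ {a a′ b} → a A.≈ a′ → (a ⊗ₑ b) T.≈ (a′ ⊗ₑ b)
  ⊗-congʳ eq = rel (⊗-cong eq B.refl)

  ⊗-εˡ : ∀ b → (A.ε ⊗ₑ b) T.≈ 𝟘
  ⊗-εˡ b = additive-ε A (A ⊗ B) ⊗-congʳ (λ a a′ → rel (⊗-distʳ a a′ b))

  ⊗-εʳ : ∀ a → (a ⊗ₑ B.ε) T.≈ 𝟘
  ⊗-εʳ a = additive-ε B (A ⊗ B) ⊗-congˡ (λ b b′ → rel (⊗-distˡ a b b′))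

span-mono : ∀ {A : Ab} {P Q : Pred ∣ A ∣ 0ℓ} → (∀ {x} → P x → Q x) → ∀ {x} → Span A P x → Span A Q x
span-mono P⊆Q (incl p)   = incl (P⊆Q p)
span-mono P⊆Q (resp e p) = resp e (span-mono P⊆Q p)
span-mono P⊆Q zero       = zero
span-mono P⊆Q (plus p q) = plus (span-mono P⊆Q p) (span-mono P⊆Q q)
span-mono P⊆Q (minus p)  = minus (span-mono P⊆Q p)

-- The product

module _ {X : Set} where

  ++-injective : ∀ {u u′ v v′ : List X} → length u ≡ length u′ → u ++ v ≡ u′ ++ v′ → u ≡ u′ × v ≡ v′
  ++-injective {[]}    {[]}     _   eq = refl , eq
  ++-injective {x ∷ u} {y ∷ u′} len eq with ∷-injective eq
  ... | refl , eq′ with ++-injective {u} {u′} (ℕ.suc-injective len) eq′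
  ...   | refl , v≡v′ = refl , v≡v′

  take-++ : ∀ (u : List X) {v n} → length u ≡ n → take n (u ++ v) ≡ u
  take-++ []      refl = refl
  take-++ (x ∷ u) refl = cong (x ∷_) (take-++ u refl)

  drop-++ : ∀ (u : List X) {v n} → length u ≡ n → drop n (u ++ v) ≡ v
  drop-++ []      refl = refl
  drop-++ (x ∷ u) refl = drop-++ u refl

  select-filter : {P : Pred X 0ℓ} (P? : Decidable P) (xs : List X) → map proj₁ (select P? xs) ≡ filter P? xs
  select-filter P? [] = refl
  select-filter P? (x ∷ xs) with P? x
  ... | yes _ = cong (x ∷_) (select-filter P? xs)
  ... | no _  = select-filter P? xs

  unique-concatMap : {Y : Set} {f : X → List Y} {xs : List X} → Unique xs →
    (∀ {x} → x ∈ xs → Unique (f x)) →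
    (∀ {x x′ y} → x ∈ xs → x′ ∈ xs → y ∈ f x → y ∈ f x′ → x ≡ x′) → Unique (concatMap f xs)
  unique-concatMap [] _ _ = []
  unique-concatMap {f = f} {x ∷ xs} (x∉ ∷ xs!) f! disjoint = Unique.++⁺ (f! (here refl))
    (unique-concatMap xs! (f! ∘ there) λ a b → disjoint (there a) (there b))
    λ (y∈fx , y∈rest) → let (x′ , x′∈ , y∈fx′) = find (concatMap⁻ f {xs = xs} y∈rest) in
      All.lookup x∉ x′∈ (disjoint (here refl) (there x′∈) y∈fx y∈fx′)

words-unique : ∀ m n → Unique (words m n)
words-unique m zero    = [] ∷ []
words-unique m (suc n) =
  Unique.cartesianProductWith⁺ _∷_ ∷-injective (Unique.map⁺ ℕ.suc-injective (Unique.upTo⁺ m)) (words-unique m n)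

∈-words⁺ : ∀ {m} w → (∀ {k} → k ∈ w → [ 1 ‥ m ] k) → w ∈ words m (length w)
∈-words⁺ []      _ = here refl
∈-words⁺ (x ∷ w) ⊆ = ∈-cartesianProductWith⁺ _∷_ (letter (⊆ (here refl))) (∈-words⁺ w (⊆ ∘ there))
  where
  letter : ∀ {m k} → [ 1 ‥ m ] k → k ∈ map suc (upTo m)
  letter (s≤s _ , k<m) = ∈-map⁺ suc (∈-upTo⁺ k<m)

-- y is one of the terms of u ✶ v.
record Product (p : ℕ) (u v y : Word) : Set where
  constructor mkProduct
  field
    permutation   : IsPermutation y
    -- The cut `p` is a parameter of its own, so replacing `u` by a rearrangement leaves the cut in
    -- place.
    length-prefix : length u ≡ p
    length-≡      : length y ≡ p + length v
    st-prefix     : st (take p y) ≡ u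
    st-suffix     : st (drop p y) ≡ v

  unique : Unique y
  unique = permutation-unique permutation

open Product

product-prefix-unique : ∀ {p u u′ v v′ y} → Product p u v y → Product p u′ v′ y → u ≡ u′
product-prefix-unique pr (mkProduct _ _ _ refl _) = sym (st-prefix pr)

product-suffix-unique : ∀ {p u u′ v v′ y} → Product p u v y → Product p u′ v′ y → v ≡ v′
product-suffix-unique pr (mkProduct _ _ _ _ refl) = sym (st-suffix pr)

product-resize : ∀ {m n u v y} → m ≡ n → Product m u v y → Product n u v y
product-resize refl pr = pr

product-swapˡ : ∀ {p u v y i} → suc i < p → Product p u v y → Product p (swapAt i u) v (swapAt i y)
product-swapˡ {p} {u} {v} {y} {i} i<p pr@(mkProduct y-perm lu len stu stv) = mkProduct
  (permutation-resp-↭ (↭-sym (swapAt-↭ i y)) y-perm)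
  (trans (↭-length (swapAt-↭ i u)) lu) (trans (↭-length (swapAt-↭ i y)) len) prefix suffix
  where
  prefix : st (take p (swapAt i y)) ≡ swapAt i u
  prefix rewrite take-swapAt i<p y | st-swapAt i (Unique.take⁺ p (unique pr)) = cong (swapAt i) stu
  suffix : st (drop p (swapAt i y)) ≡ v
  suffix rewrite drop-swapAt i<p y = stv

product-swapʳ : ∀ {p u v y} i → Product p u v y → Product p u (swapAt i v) (swapAt (p + i) y)
product-swapʳ {p} {u} {v} {y} i pr@(mkProduct y-perm lu len stu stv) = mkProduct
  (permutation-resp-↭ (↭-sym (swapAt-↭ (p + i) y)) y-perm) lu
  (trans (↭-length (swapAt-↭ (p + i) y)) (trans len (cong (p +_) (sym (↭-length (swapAt-↭ i v)))))) prefix suffix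
  where
  prefix : st (take p (swapAt (p + i) y)) ≡ u
  prefix rewrite take-swapAt-+ p i y = stu
  suffix : st (drop p (swapAt (p + i) y)) ≡ swapAt i v
  suffix rewrite drop-swapAt-+ p i y | st-swapAt i (Unique.drop⁺ p (unique pr)) = cong (swapAt i) stv

products : Permutation → Permutation → List Word
products p q = map (λ (_ , c) → word (concatenation {p} {q} c)) (contributions p q)

module _ (p q : Permutation) where
  private
    n : ℕ
    n = size p + size q

    candidates : List (Word × Word)
    candidates = cartesianProduct (words n (size p)) (words n (size q))

    products-filter : products p q ≡ map (uncurry _++_) (filter (contributes? p q) candidates)
    products-filter = trans (map-∘ {g = uncurry _++_} {f = proj₁} (contributions p q))
      (cong (map (uncurry _++_)) (select-filter (contributes? p q) candidates))

    st-length : ∀ u r → st u ≡ word r → length u ≡ size r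
    st-length u r eq = trans (sym (length-st u)) (cong length eq)

  -- `st` preserves length, so `u` has length `size p` and the pair (u, v) can be read off from
  -- `u ++ v`.
  products-unique : Unique (products p q)
  products-unique = subst Unique (sym products-filter) (unique-map
    (λ {(u , v)} {(u′ , v′)} x∈ y∈ eq → let (_ , stu , _) = contributes x∈ ; (_ , stu′ , _) = contributes y∈ in
      uncurry (cong₂ _,_) (++-injective (trans (st-length u p stu) (sym (st-length u′ p stu′))) eq))
    (Unique.filter⁺ (contributes? p q) (Unique.cartesianProduct⁺ (words-unique n (size p)) (words-unique n (size q)))))
    where
    contributes : ∀ {x} → x ∈ filter (contributes? p q) candidates → Contributes p q x
    contributes x∈ = proj₂ (∈-filter⁻ (contributes? p q) {xs = candidates} x∈)

  ∈-products : ∀ {y} → y ∈ products p q ⇔ Product (size p) (word p) (word q) y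
  ∈-products = mk⇔ fwd′ bwd′
    where
    fwd′ : ∀ {y} → y ∈ products p q → Product (size p) (word p) (word q) y
    fwd′ y∈ with ∈-map⁻ _ y∈
    ... | ((u , v) , c@(_ , stu , stv)) , _ , refl = mkProduct
      (isPermutation (concatenation {p} {q} c)) refl
      (trans (length-++ u) (cong₂ _+_ (st-length u p stu) (st-length v q stv)))
      (trans (cong st (take-++ u (st-length u p stu))) stu)
      (trans (cong st (drop-++ u (st-length u p stu))) stv)
    bwd′ : ∀ {y} → Product (size p) (word p) (word q) y → y ∈ products p q
    bwd′ {y} (mkProduct y-perm refl len stu stv) = subst (y ∈_) (sym products-filter)
      (subst (_∈ map (uncurry _++_) (filter (contributes? p q) candidates)) (take++drop≡id (size p) y)
        (∈-map⁺ (uncurry _++_) (∈-filter⁺ (contributes? p q)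
          (∈-cartesianProduct⁺ (subst (λ m → u ∈ words n m) (st-length u p stu) (∈-words⁺ u (⊆ ∘ inj₁)))
                               (subst (λ m → v ∈ words n m) (st-length v q stv) (∈-words⁺ v (⊆ ∘ inj₂))))
          ((⊆ , ⊇) , stu , stv))))
      where
      u v : Word
      u = take (size p) y
      v = drop (size p) y
      ⊆ : ∀ {k} → k ∈ u ⊎ k ∈ v → [ 1 ‥ n ] k
      ⊆ {k} k∈ = subst (λ m → [ 1 ‥ m ] k) len (proj₁ y-perm ([ ∈-take (size p) , ∈-drop (size p) ]′ k∈))
      ⊇ : ∀ {k} → [ 1 ‥ n ] k → k ∈ u ⊎ k ∈ v
      ⊇ {k} r = ∈-++⁻ u (subst (k ∈_) (sym (take++drop≡id (size p) y))
        (proj₂ y-perm (subst (λ m → [ 1 ‥ m ] k) (sym len) r)))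

-- Through `std` any word names a generator without a proof attached. On permutations nothing
-- changes, because `st` fixes them.
⟦_⟧ : Word → ∣ ℤ𝔖 ∣
⟦ w ⟧ = gen (std w)

gen-cong′ : ∀ {p q} → word p ≡ word q → gen p ℤ𝔖.≈ gen q
gen-cong′ eq = rel (gen-cong eq)

gen-std : ∀ p → gen p ℤ𝔖.≈ ⟦ word p ⟧
gen-std p = gen-cong′ (sym (st-permutation (isPermutation p)))

wordSum : List Word → ∣ ℤ𝔖 ∣
wordSum L = ∑ ℤ𝔖 (map ⟦_⟧ L)

wordSum-set : ∀ {L L′} → Unique L → Unique L′ → (∀ {y} → y ∈ L ⇔ y ∈ L′) → wordSum L ℤ𝔖.≈ wordSum L′
wordSum-set L! L′! eq = ∑-↭ ℤ𝔖 (unique-set⇒↭ L! L′! eq)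

✶-gen : ∀ p q → gen p ✶ gen q ℤ𝔖.≈ wordSum (products p q)
✶-gen p q = ℤ𝔖.trans (∑-cong ℤ𝔖 (contributions p q) λ {c} _ → gen-std (concatenation {p} {q} (proj₂ c)))
  (ℤ𝔖.sym (∑-map ℤ𝔖 _ (contributions p q)))

wordSum-products : ∀ p q p′ q′ → (∀ {y} → Product (size p) (word p) (word q) y ⇔ Product (size p′) (word p′) (word q′) y) →
                   wordSum (products p q) ℤ𝔖.≈ wordSum (products p′ q′)
wordSum-products p q p′ q′ eq = wordSum-set (products-unique p q) (products-unique p′ q′)
  (mk⇔ (from (∈-products p′ q′) ∘ to eq ∘ to (∈-products p q))
       (from (∈-products p q) ∘ from eq ∘ to (∈-products p′ q′)))

-- Equal words may carry different proofs of being permutations, so the two products are compared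
-- through their sets of words.
✶-gen-cong : ∀ {p q p′ q′} → word p ≡ word p′ → word q ≡ word q′ → gen p ✶ gen q ℤ𝔖.≈ gen p′ ✶ gen q′
✶-gen-cong {p} {q} {p′} {q′} refl refl = ℤ𝔖.trans (✶-gen p q)
  (ℤ𝔖.trans (wordSum-products p q p′ q′ (mk⇔ (λ x → x) (λ x → x))) (ℤ𝔖.sym (✶-gen p′ q′)))

✶-homˡ : ∀ b → IsTermHom ℤ𝔖 (_✶ b)
✶-homˡ b = extend-hom ℤ𝔖 _

-- `_✶_` recurses on its left argument first. Additivity there is definitional, while here it is
-- built up along `a`.
✶-homʳ : ∀ a → IsTermHom ℤ𝔖 (a ✶_)
✶-homʳ (gen p) = extend-hom ℤ𝔖 _
✶-homʳ 𝟘       = zero-hom ℤ𝔖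
✶-homʳ (s ⊕ t) = ∙-hom ℤ𝔖 (✶-homʳ s) (✶-homʳ t)
✶-homʳ (⊖ t)   = ⁻¹-hom ℤ𝔖 (✶-homʳ t)

✶-congˡ : ∀ a {b b′} → b ℤ𝔖.≈ b′ → a ✶ b ℤ𝔖.≈ a ✶ b′
✶-congˡ a = termHom-cong ℤ𝔖 (✶-homʳ a) λ { (gen-cong {q} {q′} eq) →
  termHom-ext ℤ𝔖 (✶-homˡ (gen q)) (✶-homˡ (gen q′)) (λ p → ✶-gen-cong {p} {q} {p} {q′} refl eq) a }

✶-congʳ : ∀ b {a a′} → a ℤ𝔖.≈ a′ → a ✶ b ℤ𝔖.≈ a′ ✶ b
✶-congʳ b = termHom-cong ℤ𝔖 (✶-homˡ b) λ { (gen-cong {p} {p′} eq) →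
  termHom-ext ℤ𝔖 (✶-homʳ (gen p)) (✶-homʳ (gen p′)) (λ q → ✶-gen-cong {p} {q} {p′} {q} eq refl) b }

product-[]ˡ : ∀ {v y} → IsPermutation v → Product 0 [] v y ⇔ y ≡ v
product-[]ˡ {v} v-perm = mk⇔ (λ pr → trans (sym (st-permutation (permutation pr))) (st-suffix pr))
  (λ y≡v → subst (Product 0 [] v) (sym y≡v) (mkProduct v-perm refl refl refl (st-permutation v-perm)))

product-[]ʳ : ∀ {u y} → IsPermutation u → Product (length u) u [] y ⇔ y ≡ u
product-[]ʳ {u} {y} u-perm = mk⇔ fwd′ (λ y≡u → subst (Product (length u) u []) (sym y≡u) self)
  where
  fwd′ : Product (length u) u [] y → y ≡ u
  fwd′ (mkProduct y-perm _ len stu _)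
    rewrite take-all (length u) y (ℕ.≤-reflexive (trans len (ℕ.+-identityʳ _))) =
    trans (sym (st-permutation y-perm)) stu
  self : Product (length u) u [] u
  self = mkProduct u-perm refl (sym (ℕ.+-identityʳ _)) prefix suffix
    where
    prefix : st (take (length u) u) ≡ u
    prefix rewrite take-all (length u) u ℕ.≤-refl = st-permutation u-perm
    suffix : st (drop (length u) u) ≡ []
    suffix rewrite drop-all (length u) u ℕ.≤-refl = refl

module _ (p q r : Permutation) (eq : ∀ {y} → Product (size p) (word p) (word q) y ⇔ y ≡ word r) where

  ✶-gen-singleton : gen p ✶ gen q ℤ𝔖.≈ gen r
  ✶-gen-singleton = ℤ𝔖.trans (✶-gen p q) (ℤ𝔖.trans
    (wordSum-set {L′ = word r ∷ []} (products-unique p q) ([] ∷ [])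
      (mk⇔ (here ∘ to eq ∘ to (∈-products p q)) λ { (here e) → from (∈-products p q) (from eq e) ; (there ()) }))
    (ℤ𝔖.trans (ℤ𝔖.identityʳ _) (ℤ𝔖.sym (gen-std r))))

✶-identityˡ : ∀ a → 𝟙 ✶ a ℤ𝔖.≈ a
✶-identityˡ = termHom-ext ℤ𝔖 (✶-homʳ 𝟙) id-hom λ q →
  ✶-gen-singleton (std []) q q (product-[]ˡ (isPermutation q))

✶-identityʳ : ∀ a → a ✶ 𝟙 ℤ𝔖.≈ a
✶-identityʳ = termHom-ext ℤ𝔖 (✶-homˡ 𝟙) id-hom λ p →
  ✶-gen-singleton p (std []) p (product-[]ʳ (isPermutation p))

-- The terms of a threefold product, described by two cuts and without bracketing; both bracketings
-- are shown to enumerate exactly these words.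
record Product₃ (p q : ℕ) (u v w y : Word) : Set where
  constructor mkProduct₃
  field
    permutation   : IsPermutation y
    length-prefix : length u ≡ p
    length-middle : length v ≡ q
    length-≡      : length y ≡ p + (q + length w)
    st-prefix     : st (take p y) ≡ u
    st-middle     : st (take q (drop p y)) ≡ v
    st-suffix     : st (drop q (drop p y)) ≡ w

module _ {p q : ℕ} {u v w y : Word} where

  -- The intermediate term is forced: it is the standardization of the first p + q letters of `y`.
  product₃-left : Product₃ p q u v w y ⇔ (∃ λ x → Product p u v x × Product (p + q) x w y)
  product₃-left = mk⇔ split merge
    where
    split : Product₃ p q u v w y → ∃ λ x → Product p u v x × Product (p + q) x w y
    split (mkProduct₃ y-perm lu refl len stu stv stw) =
      st (take (p + q) y) ,
      mkProduct (st-isPermutation (take (p + q) y)) lu len-x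
        (trans (st-take-take p q y (permutation-unique y-perm)) stu)
        (trans (st-drop-take p q y (permutation-unique y-perm)) stv) ,
      mkProduct y-perm len-x (trans len (sym (ℕ.+-assoc p q _))) refl (trans (st-drop-drop p q y) stw)
      where
      len-x : length (st (take (p + q) y)) ≡ p + q
      len-x = trans (length-st (take (p + q) y)) (trans (length-take (p + q) y) (ℕ.m≤n⇒m⊓n≡m
        (subst (p + q ≤_) (sym len) (ℕ.+-monoʳ-≤ p (ℕ.m≤m+n q _)))))
    merge : (∃ λ x → Product p u v x × Product (p + q) x w y) → Product₃ p q u v w y
    merge (_ , mkProduct x-perm lu len-x stu stv , mkProduct y-perm lx len refl stw) = mkProduct₃ y-perm lu
      (ℕ.+-cancelˡ-≡ p _ _ (trans (sym len-x) lx))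
      (trans len (ℕ.+-assoc p q _))
      (trans (sym (st-take-take p q y (permutation-unique y-perm))) stu)
      (trans (sym (st-drop-take p q y (permutation-unique y-perm))) stv)
      (trans (sym (st-drop-drop p q y)) stw)

  product₃-right : Product₃ p q u v w y ⇔ (∃ λ z → Product q v w z × Product p u z y)
  product₃-right = mk⇔ split merge
    where
    split : Product₃ p q u v w y → ∃ λ z → Product q v w z × Product p u z y
    split (mkProduct₃ y-perm lu lv len stu stv stw) =
      st (drop p y) ,
      mkProduct (st-isPermutation (drop p y)) lv len-z
        (trans (st-take q (drop p y) (Unique.drop⁺ p (permutation-unique y-perm))) stv)
        (trans (st-drop q (drop p y) (Unique.drop⁺ p (permutation-unique y-perm))) stw) ,
      mkProduct y-perm lu (trans len (cong (p +_) (sym len-z))) stu refl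
      where
      len-z : length (st (drop p y)) ≡ q + length w
      len-z = trans (length-st (drop p y)) (trans (length-drop p y) (trans (cong (_∸ p) len) (ℕ.m+n∸m≡n p _)))
    merge : (∃ λ z → Product q v w z × Product p u z y) → Product₃ p q u v w y
    merge (_ , mkProduct z-perm lv len-z stv stw , mkProduct y-perm lu len stu refl) =
      mkProduct₃ y-perm lu lv (trans len (cong (p +_) len-z)) stu
        (trans (sym (st-take q (drop p y) (Unique.drop⁺ p (permutation-unique y-perm)))) stv)
        (trans (sym (st-drop q (drop p y) (Unique.drop⁺ p (permutation-unique y-perm)))) stw)

module _ (p q r : Permutation) where
  private
    multiplyʳ multiplyˡ : Word → List Word
    multiplyʳ x = products (std x) r
    multiplyˡ z = products p (std z)

    leftProducts rightProducts : List Word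
    leftProducts  = concatMap multiplyʳ (products p q)
    rightProducts = concatMap multiplyˡ (products q r)

    -- The outer product is taken with `std x`, whose word is `st x`; it equals `x` because terms of
    -- a product are permutations.
    ∈-products-stdˡ : ∀ {x y} → x ∈ products p q → y ∈ multiplyʳ x ⇔ Product (size p + size q) x (word r) y
    ∈-products-stdˡ {x} {y} x∈ = subst₂ (λ n u → y ∈ multiplyʳ x ⇔ Product n u (word r) y)
      (trans (length-st x) (length-≡ pr)) (st-permutation (permutation pr)) (∈-products (std x) r)
      where
      pr : Product (size p) (word p) (word q) x
      pr = to (∈-products p q) x∈

    ∈-products-stdʳ : ∀ {z y} → z ∈ products q r → y ∈ multiplyˡ z ⇔ Product (size p) (word p) z y
    ∈-products-stdʳ {z} {y} z∈ = subst (λ u → y ∈ multiplyˡ z ⇔ Product (size p) (word p) u y)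
      (st-permutation (permutation (to (∈-products q r) z∈))) (∈-products p (std z))

    ∈-left : ∀ {y} → y ∈ leftProducts ⇔ Product₃ (size p) (size q) (word p) (word q) (word r) y
    ∈-left = mk⇔
      (λ y∈ → let (x , x∈ , y∈x) = find (concatMap⁻ multiplyʳ {xs = products p q} y∈) in
        from product₃-left (x , to (∈-products p q) x∈ , to (∈-products-stdˡ x∈) y∈x))
      (λ pr → let (x , px , py) = to product₃-left pr ; x∈ = from (∈-products p q) px in
        concatMap⁺ multiplyʳ (lose x∈ (from (∈-products-stdˡ x∈) py)))

    ∈-right : ∀ {y} → y ∈ rightProducts ⇔ Product₃ (size p) (size q) (word p) (word q) (word r) y
    ∈-right = mk⇔
      (λ y∈ → let (z , z∈ , y∈z) = find (concatMap⁻ multiplyˡ {xs = products q r} y∈) in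
        from product₃-right (z , to (∈-products q r) z∈ , to (∈-products-stdʳ z∈) y∈z))
      (λ pr → let (z , pz , py) = to product₃-right pr ; z∈ = from (∈-products q r) pz in
        concatMap⁺ multiplyˡ (lose z∈ (from (∈-products-stdʳ z∈) py)))

    -- The lists joined here are disjoint: a common word would determine the intermediate term by
    -- standardizing its prefix.
    left! : Unique leftProducts
    left! = unique-concatMap (products-unique p q) (λ {x} _ → products-unique (std x) r) λ x∈ x′∈ y∈ y∈′ →
      product-prefix-unique (to (∈-products-stdˡ x∈) y∈) (to (∈-products-stdˡ x′∈) y∈′)

    right! : Unique rightProducts
    right! = unique-concatMap (products-unique q r) (λ {z} _ → products-unique p (std z)) λ z∈ z′∈ y∈ y∈′ →
      product-suffix-unique (to (∈-products-stdʳ z∈) y∈) (to (∈-products-stdʳ z′∈) y∈′)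

  open SetoidReasoning ℤ𝔖.setoid

  ✶-gen-assoc : (gen p ✶ gen q) ✶ gen r ℤ𝔖.≈ gen p ✶ (gen q ✶ gen r)
  ✶-gen-assoc = begin
    (gen p ✶ gen q) ✶ gen r             ≈⟨ ✶-congʳ (gen r) (✶-gen p q) ⟩
    wordSum (products p q) ✶ gen r      ≈⟨ termHom-∑ ℤ𝔖 (✶-homˡ (gen r)) (products p q) ⟩
    ∑ ℤ𝔖 (map (λ x → ⟦ x ⟧ ✶ gen r) (products p q))
      ≈⟨ ∑-cong ℤ𝔖 (products p q) (λ {x} _ → ✶-gen (std x) r) ⟩
    ∑ ℤ𝔖 (map (λ x → wordSum (products (std x) r)) (products p q))
      ≈⟨ ∑-concatMap ℤ𝔖 multiplyʳ (products p q) ⟨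
    wordSum leftProducts
      ≈⟨ wordSum-set left! right! (mk⇔ (from ∈-right ∘ to ∈-left) (from ∈-left ∘ to ∈-right)) ⟩
    wordSum rightProducts               ≈⟨ ∑-concatMap ℤ𝔖 multiplyˡ (products q r) ⟩
    ∑ ℤ𝔖 (map (λ z → wordSum (products p (std z))) (products q r))
      ≈⟨ ∑-cong ℤ𝔖 (products q r) (λ {z} _ → ✶-gen p (std z)) ⟨
    ∑ ℤ𝔖 (map (λ z → gen p ✶ ⟦ z ⟧) (products q r))
      ≈⟨ termHom-∑ ℤ𝔖 (✶-homʳ (gen p)) (products q r) ⟨
    gen p ✶ wordSum (products q r)      ≈⟨ ✶-congˡ (gen p) (✶-gen q r) ⟨
    gen p ✶ (gen q ✶ gen r)             ∎

✶-assoc : ∀ a b c → (a ✶ b) ✶ c ℤ𝔖.≈ a ✶ (b ✶ c)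
✶-assoc a b c = termHom-ext ℤ𝔖 {F = λ a → (a ✶ b) ✶ c} {H = λ a → a ✶ (b ✶ c)}
  (∘-hom ℤ𝔖 (✶-homˡ c) (✶-congʳ c) (✶-homˡ b)) (✶-homˡ (b ✶ c)) (λ p →
  termHom-ext ℤ𝔖 {F = λ b → (gen p ✶ b) ✶ c} {H = λ b → gen p ✶ (b ✶ c)}
    (∘-hom ℤ𝔖 (✶-homˡ c) (✶-congʳ c) (✶-homʳ (gen p))) (∘-hom ℤ𝔖 (✶-homʳ (gen p)) (✶-congˡ (gen p)) (✶-homˡ c)) (λ q →
  termHom-ext ℤ𝔖 (✶-homʳ (gen p ✶ gen q)) (∘-hom ℤ𝔖 (✶-homʳ (gen p)) (✶-congˡ (gen p)) (✶-homʳ (gen q))) (λ r →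
    ✶-gen-assoc p q r) c) b) a

-- Ideals generated by moves

-- Stated under an additive `H`, so that the expansion applies inside tensor maps and in quotients.
-- The upper end `size p` appears as `i + j`, the form in which restrictions compose.
Δ-expand : (A : Ab) {H : ∣ ℤ𝔖 ⊗ ℤ𝔖 ∣ → ∣ A ∣} → IsTermHom A H → ∀ p {n} → size p ≡ n →
  A ∋ H (Δ (gen p)) ≈ antidiagonal A n (λ i j → H (⟦ word p ∣[ 1 ‥ i ] ⟧ ⊗ₑ ⟦ word p ∣[ suc i ‥ i + j ] ⟧))
Δ-expand A {H} H-hom p refl = A.trans (termHom-∑ A H-hom (upTo (suc (size p))))
  (∑-antidiagonal A (size p) λ i j eq →
    A.reflexive (cong (λ m → H (⟦ word p ∣[ 1 ‥ i ] ⟧ ⊗ₑ ⟦ word p ∣[ suc i ‥ m ] ⟧)) (sym eq)))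
  where module A = AbelianGroup A

module SwapIdeal {_∼_ : Rel Word 0ℓ} (moves : Moves _∼_) where
  open Moves moves

  Equivalent : Rel Permutation 0ℓ
  Equivalent u v = EqClosure _∼_ (word u) (word v)

  J : Pred ∣ ℤ𝔖 ∣ 0ℓ
  J = Span ℤ𝔖 (Differences Equivalent)

  J-isSubgroup : IsSubgroup ℤ𝔖 J
  J-isSubgroup = span-isSubgroup ℤ𝔖 (Differences Equivalent)

  Q : Ab
  Q = quotient ℤ𝔖 J-isSubgroup

  private module Q = AbelianGroup Q

  ≈⇒Q : ∀ {a b} → a ℤ𝔖.≈ b → a Q.≈ b
  ≈⇒Q {a} {b} = quotient-≈ ℤ𝔖 J-isSubgroup {a} {b}

  module _ (B : Ab) {F : ∣ ℤ𝔖 ∣ → ∣ B ∣} (F-hom : IsTermHom B F)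
    (F-cong : ∀ {p q} → word p ≡ word q → B ∋ F (gen p) ≈ F (gen q))
    (F-step : ∀ {p q} → word p ∼ word q → B ∋ F (gen p) ≈ F (gen q)) where
    private module B = AbelianGroup B

    -- Invariance under single moves gives invariance along chains: every intermediate word is a
    -- rearrangement of a permutation, hence itself a generator on which `F` is defined.
    J-annihilated : ∀ {a} → J a → F a B.≈ B.ε
    J-annihilated = termHom-span B F-hom (λ { (gen-cong {p} {q} eq) → F-cong {p} {q} eq })
      λ { (p , q , p∼q , refl) → termHom-difference B F-hom (chain p∼q (isPermutation p) (isPermutation q)) }
      where
      chain : ∀ {u v} → EqClosure _∼_ u v → (u-perm : IsPermutation u) (v-perm : IsPermutation v) →
              F (gen (perm u u-perm)) B.≈ F (gen (perm v v-perm))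
      -- Even an empty chain joins two possibly different proofs for the same word.
      chain ε u-perm v-perm = F-cong refl
      chain (fwd m ◅ ms) u-perm v-perm =
        let w-perm = permutation-resp-↭ (∼⇒↭ m) u-perm in
        B.trans (F-step {perm _ u-perm} {perm _ w-perm} m) (chain ms w-perm v-perm)
      chain (bwd m ◅ ms) u-perm v-perm =
        let w-perm = permutation-resp-↭ (↭-sym (∼⇒↭ m)) u-perm in
        B.trans (B.sym (F-step {perm _ w-perm} {perm _ u-perm} m)) (chain ms w-perm v-perm)

  -- The difference lies in J between standardized words, so the move is first carried over to
  -- `st w`.
  swap-≈ : ∀ {i w} → Unique w → At i w → ⟦ w ⟧ Q.≈ ⟦ swapAt i w ⟧
  swap-≈ {i} {w} w! at = incl (std w , std (swapAt i w) , fwd step ◅ ε , refl)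
    where
    step : st w ∼ st (swapAt i w)
    step rewrite st-swapAt i w! = At⇒∼ (At-st⁺ w! at)

  module _ (p q p′ q′ : Permutation) (j : ℕ)
    (swap⁺ : ∀ {y} → Product (size p) (word p) (word q) y → Product (size p′) (word p′) (word q′) (swapAt j y))
    (swap⁻ : ∀ {y} → Product (size p′) (word p′) (word q′) y → Product (size p) (word p) (word q) (swapAt j y))
    (at    : ∀ {y} → Product (size p) (word p) (word q) y → At j y) where

    open SetoidReasoning Q.setoid
    private
      L : List Word
      L = products p q

      ∈-swapped : ∀ {y} → y ∈ map (swapAt j) L ⇔ y ∈ products p′ q′
      ∈-swapped {y} = mk⇔ fwd′ bwd′
        where
        fwd′ : y ∈ map (swapAt j) L → y ∈ products p′ q′
        fwd′ y∈ with ∈-map⁻ (swapAt j) y∈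
        ... | x , x∈ , refl = from (∈-products p′ q′) (swap⁺ (to (∈-products p q) x∈))
        bwd′ : y ∈ products p′ q′ → y ∈ map (swapAt j) L
        bwd′ y∈ = subst (_∈ map (swapAt j) L) (swapAt-involutive j y)
          (∈-map⁺ (swapAt j) (from (∈-products p q) (swap⁻ (to (∈-products p′ q′) y∈))))

    -- Each term is congruent to its exchange at `j`, and the exchanged terms are exactly those of
    -- the other product. The position `j` is the same for all terms.
    ✶-swap : gen p ✶ gen q Q.≈ gen p′ ✶ gen q′
    ✶-swap = begin
      gen p ✶ gen q                            ≈⟨ ≈⇒Q (✶-gen p q) ⟩
      wordSum L
        ≈⟨ ∑-cong Q L (λ y∈ → let pr = to (∈-products p q) y∈ in swap-≈ (unique pr) (at pr)) ⟩
      ∑ ℤ𝔖 (map (λ y → ⟦ swapAt j y ⟧) L)      ≈⟨ ≈⇒Q (∑-map ℤ𝔖 (swapAt j) L) ⟨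
      wordSum (map (swapAt j) L)
        ≈⟨ ≈⇒Q (wordSum-set (Unique.map⁺ (swapAt-injective j) (products-unique p q)) (products-unique p′ q′) ∈-swapped) ⟩
      wordSum (products p′ q′)                 ≈⟨ ≈⇒Q (✶-gen p′ q′) ⟨
      gen p′ ✶ gen q′                          ∎

  ✶-gen-stepˡ : ∀ p p′ q → word p ∼ word p′ → gen p ✶ gen q Q.≈ gen p′ ✶ gen q
  ✶-gen-stepˡ p (perm _ p′-perm) q m with ∼⇒At m
  ... | i , at-p , refl = ✶-swap p q (perm _ p′-perm) q i
    (λ pr → product-resize (sym len) (product-swapˡ i<p pr))
    -- The inverse map is the same exchange, applied to the already exchanged factor.
    (λ {y} pr → subst (λ u → Product (size p) u (word q) (swapAt i y)) (swapAt-involutive i (word p))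
      (product-swapˡ i<p (product-resize len pr)))
    -- The move passes from the factor, which is `st` of the prefix, to the prefix and then to all
    -- of `y`.
    (λ pr → At-take⁻ (size p) (At-st⁻ (Unique.take⁺ (size p) (unique pr)) (subst (At i) (sym (st-prefix pr)) at-p)))
    where
    len : length (swapAt i (word p)) ≡ size p
    len = ↭-length (swapAt-↭ i (word p))
    i<p : suc i < size p
    i<p = At-length at-p

  ✶-absorbs : ∀ {a} b → J a → J (a ✶ b)
  ✶-absorbs b = quotient-ε⇒∈ ℤ𝔖 J-isSubgroup ∘ J-annihilated Q
    (quotient-hom ℤ𝔖 J-isSubgroup (✶-homˡ b))
    (λ {p} {q} eq → ≈⇒Q {gen p ✶ b} {gen q ✶ b} (✶-congʳ b (gen-cong′ eq)))
    (λ {p} {p′} m → termHom-ext Q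
      (quotient-hom ℤ𝔖 J-isSubgroup (✶-homʳ (gen p))) (quotient-hom ℤ𝔖 J-isSubgroup (✶-homʳ (gen p′)))
      (λ q → ✶-gen-stepˡ p p′ q m) b)

  module _ (At-drop⁻ : ∀ {i w} p → At i (drop p w) → At (p + i) w) where

    -- A move at `i` in the right factor acts at `size p + i` in each term; `At-drop⁻` is what keeps
    -- it legal there.
    ✶-gen-stepʳ : ∀ p q q′ → word q ∼ word q′ → gen p ✶ gen q Q.≈ gen p ✶ gen q′
    ✶-gen-stepʳ p q (perm _ q′-perm) m with ∼⇒At m
    ... | i , at-q , refl = ✶-swap p q p (perm _ q′-perm) (size p + i)
      (product-swapʳ i)
      (λ {y} pr → subst (λ v → Product (size p) (word p) v (swapAt (size p + i) y)) (swapAt-involutive i (word q))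
        (product-swapʳ i pr))
      (λ pr → At-drop⁻ (size p) (At-st⁻ (Unique.drop⁺ (size p) (unique pr)) (subst (At i) (sym (st-suffix pr)) at-q)))

    ✶-absorbsˡ : ∀ a {b} → J b → J (a ✶ b)
    ✶-absorbsˡ a = quotient-ε⇒∈ ℤ𝔖 J-isSubgroup ∘ J-annihilated Q
      (quotient-hom ℤ𝔖 J-isSubgroup (✶-homʳ a))
      (λ {p} {q} eq → ≈⇒Q {a ✶ gen p} {a ✶ gen q} (✶-congˡ a (gen-cong′ eq)))
      (λ {q} {q′} m → termHom-ext Q
        (quotient-hom ℤ𝔖 J-isSubgroup (✶-homˡ (gen q))) (quotient-hom ℤ𝔖 J-isSubgroup (✶-homˡ (gen q′)))
        (λ p → ✶-gen-stepʳ p q q′ m) a)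

  restrict-≈ : ∀ {i w} a b → Unique w → At i w → ⟦ w ∣[ a ‥ b ] ⟧ Q.≈ ⟦ swapAt i w ∣[ a ‥ b ] ⟧
  restrict-≈ {i} {w} a b w! at with At-filter (between? a b) (interval-convex a b) at
  ... | inj₁ eq             = Q.reflexive (cong ⟦_⟧ (sym eq))
  ... | inj₂ (j , at′ , eq) = Q.trans (swap-≈ (restrict-unique a b w!) at′) (Q.reflexive (cong ⟦_⟧ (sym eq)))

  private
    T : Ab
    T = ℤ𝔖 ⊗ ℤ𝔖

    TJ-isSubgroup : IsSubgroup T (TensorIdeal ℤ𝔖 J)
    TJ-isSubgroup = span-isSubgroup T _

    T/J : Ab
    T/J = quotient T TJ-isSubgroup

    module T/J = AbelianGroup T/J

    ≈⇒T/J : ∀ {s t} → T ∋ s ≈ t → s T/J.≈ t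
    ≈⇒T/J {s} {t} = quotient-≈ T TJ-isSubgroup {s} {t}

    open SetoidReasoning T/J.setoid

    a-b+b≈a : ∀ a b → (a ⊕ ⊖ b) ⊕ b ℤ𝔖.≈ a
    a-b+b≈a a b = ℤ𝔖.trans (ℤ𝔖.assoc a (⊖ b) b) (ℤ𝔖.trans (ℤ𝔖.∙-congˡ (ℤ𝔖.inverseˡ b)) (ℤ𝔖.identityʳ a))

    -- One factor is changed at a time: a ⊗ b - a′ ⊗ b′ = (a - a′) ⊗ b + a′ ⊗ (b - b′).
    tensor-≈ : ∀ {a a′ b b′} → a Q.≈ a′ → b Q.≈ b′ → (a ⊗ₑ b) T/J.≈ (a′ ⊗ₑ b′)
    tensor-≈ {a} {a′} {b} {b′} a≈ b≈ = begin
      a ⊗ₑ b                                ≈⟨ ≈⇒T/J (⊗-congʳ ℤ𝔖 ℤ𝔖 (a-b+b≈a a a′)) ⟨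
      ((a ⊕ ⊖ a′) ⊕ a′) ⊗ₑ b                ≈⟨ ≈⇒T/J (rel (⊗-distʳ _ _ _)) ⟩
      (a ⊕ ⊖ a′) ⊗ₑ b ⊕ a′ ⊗ₑ b
        ≈⟨ T/J.∙-congʳ (∈⇒quotient-ε T TJ-isSubgroup (incl (_ , _ , inj₁ a≈ , refl))) ⟩
      𝟘 ⊕ a′ ⊗ₑ b                           ≈⟨ T/J.identityˡ (a′ ⊗ₑ b) ⟩
      a′ ⊗ₑ b                               ≈⟨ ≈⇒T/J (⊗-congˡ ℤ𝔖 ℤ𝔖 (a-b+b≈a b b′)) ⟨
      a′ ⊗ₑ ((b ⊕ ⊖ b′) ⊕ b′)               ≈⟨ ≈⇒T/J (rel (⊗-distˡ _ _ _)) ⟩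
      a′ ⊗ₑ (b ⊕ ⊖ b′) ⊕ a′ ⊗ₑ b′
        ≈⟨ T/J.∙-congʳ (∈⇒quotient-ε T TJ-isSubgroup (incl (_ , _ , inj₂ b≈ , refl))) ⟩
      𝟘 ⊕ a′ ⊗ₑ b′                          ≈⟨ T/J.identityˡ (a′ ⊗ₑ b′) ⟩
      a′ ⊗ₑ b′                              ∎

    Δ-step : ∀ p q → word p ∼ word q → Δ (gen p) T/J.≈ Δ (gen q)
    Δ-step p (perm _ q-perm) m with ∼⇒At m
    ... | i , at , refl = begin
      Δ (gen p)                   ≈⟨ Δ-expand T/J id-hom′ p refl ⟩
      antidiagonal T/J (size p) (λ k l → ⟦ word p ∣[ 1 ‥ k ] ⟧ ⊗ₑ ⟦ word p ∣[ suc k ‥ k + l ] ⟧)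
        ≈⟨ antidiagonal-cong T/J (size p) (λ k l _ → tensor-≈ (restrict-≈ 1 k p! at) (restrict-≈ (suc k) (k + l) p! at)) ⟩
      antidiagonal T/J (size p) (λ k l → ⟦ word q ∣[ 1 ‥ k ] ⟧ ⊗ₑ ⟦ word q ∣[ suc k ‥ k + l ] ⟧)
                                  ≈⟨ Δ-expand T/J id-hom′ q (↭-length (swapAt-↭ i (word p))) ⟨
      Δ (gen q)                   ∎
      where
      q : Permutation
      q = perm _ q-perm
      p! : Unique (word p)
      p! = permutation-unique (isPermutation p)
      id-hom′ : IsTermHom T/J (λ t → t)
      id-hom′ = quotient-hom T TJ-isSubgroup id-hom

  coideal : IsCoideal ℤ𝔖 Δ counit J
  coideal = record
    { isSubgroup = J-isSubgroup
    ; Δ-coideal  = quotient-ε⇒∈ T TJ-isSubgroup ∘ J-annihilated T/J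
        (quotient-hom T TJ-isSubgroup (extend-hom T _))
        (λ { {perm u _} {perm .u _} refl → T/J.refl })
        (λ {p} {q} → Δ-step p q)
    ; ε-coideal  = J-annihilated ℤ-group (extend-hom ℤ-group _)
        (λ { {perm u _} {perm .u _} refl → refl })
        (λ {p} {q} m → counit-length p q (↭-length (∼⇒↭ m))) }
    where
    counit-length : ∀ p q → size p ≡ size q → counit (gen p) ≡ counit (gen q)
    counit-length (perm [] _)      (perm [] _)      _  = refl
    counit-length (perm (_ ∷ _) _) (perm (_ ∷ _) _) _  = refl

-- Coalgebra structure on quotients

module QuotientCoalgebra {J : Pred ∣ ℤ𝔖 ∣ 0ℓ} (J-coideal : IsCoideal ℤ𝔖 Δ counit J) where
  open IsCoideal J-coideal

  D : Ab
  D = quotient ℤ𝔖 isSubgroup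

  private
    module D = AbelianGroup D

    D² ℤD Dℤ D³ : Ab
    D² = D ⊗ D
    ℤD = ℤ-group ⊗ D
    Dℤ = D ⊗ ℤ-group
    D³ = D ⊗ D²

    module D² = AbelianGroup D²
    module ℤD = AbelianGroup ℤD
    module Dℤ = AbelianGroup Dℤ
    module D³ = AbelianGroup D³

    ≈⇒D : ∀ {a b} → a ℤ𝔖.≈ b → a D.≈ b
    ≈⇒D {a} {b} = quotient-≈ ℤ𝔖 isSubgroup {a} {b}

    ⟦⟧-cong : ∀ {u v} → st u ≡ st v → ⟦ u ⟧ D.≈ ⟦ v ⟧
    ⟦⟧-cong {u} {v} eq = ≈⇒D {⟦ u ⟧} {⟦ v ⟧} (gen-cong′ eq)

    -- An element of C ⊗ C is read unchanged as one of D ⊗ D, where a factor from J becomes zero.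
    -- This turns the coideal property into well-definedness of `Δ` on the quotient.
    tensorIdeal-≈𝟘 : ∀ {t} → TensorIdeal ℤ𝔖 J t → t D².≈ 𝟘
    tensorIdeal-≈𝟘 = termHom-span D² id-hom
      (λ { (⊗-cong {a} {a′} {b} {b′} p q) → rel (⊗-cong (≈⇒D {a} {a′} p) (≈⇒D {b} {b′} q))
         ; (⊗-distˡ a b b′) → rel (⊗-distˡ a b b′)
         ; (⊗-distʳ a a′ b) → rel (⊗-distʳ a a′ b) })
      λ { (a , b , inj₁ a∈J , refl) → D².trans (⊗-congʳ D D (∈⇒quotient-ε ℤ𝔖 isSubgroup a∈J)) (⊗-εˡ D D b)
        ; (a , b , inj₂ b∈J , refl) → D².trans (⊗-congˡ D D (∈⇒quotient-ε ℤ𝔖 isSubgroup b∈J)) (⊗-εʳ D D a) }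

    Δ-hom : IsTermHom D² Δ
    Δ-hom = record { 𝟘-homo = D².refl ; ⊕-homo = λ _ _ → D².refl ; ⊖-homo = λ _ → D².refl }

    Δ-cong : ∀ {a b} → a D.≈ b → Δ a D².≈ Δ b
    Δ-cong {a} {b} = termHom-difference⁻ D² Δ-hom {a} {b} ∘ tensorIdeal-≈𝟘 ∘ Δ-coideal

    counit-cong : ∀ {a b} → a D.≈ b → counit a ≡ counit b
    counit-cong {a} {b} = termHom-difference⁻ ℤ-group (extend-hom ℤ-group _) {a} {b} ∘ ε-coideal

    counit-positive : ∀ u {n} → length u ≡ suc n → counit ⟦ u ⟧ ≡ 0ℤ
    counit-positive (_ ∷ _) _ = refl

    counit-empty : ∀ u → length u ≡ 0 → counit ⟦ u ⟧ ≡ 1ℤ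
    counit-empty [] _ = refl

    id : ∣ D ∣ → ∣ D ∣
    id c = c

  module _ (p : Permutation) where
    private
      w : Word
      w = word p
      n : ℕ
      n = size p
      w-perm : IsPermutation w
      w-perm = isPermutation p

      left≤ : ∀ {i j} → i + j ≡ n → i ≤ n
      left≤ {i} eq = subst (i ≤_) eq (ℕ.m≤m+n i _)

      length-left : ∀ {i j} → i + j ≡ n → length (w ∣[ 1 ‥ i ]) ≡ i
      length-left eq = length-restrict w-perm 0 _ (left≤ eq)

      length-right : ∀ {i j} → i + j ≡ n → length (w ∣[ suc i ‥ i + j ]) ≡ j
      length-right {i} {j} eq = length-restrict w-perm i j (ℕ.≤-reflexive eq)

      cut : ℕ → ℕ → ℕ → ∣ D³ ∣
      cut i j k = ⟦ w ∣[ 1 ‥ i ] ⟧ ⊗ₑ (⟦ w ∣[ suc i ‥ i + j ] ⟧ ⊗ₑ ⟦ w ∣[ suc (i + j) ‥ i + j + k ] ⟧)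

      cut-left : ∀ {m k} → m + k ≡ n → ∀ i j → i + j ≡ m →
        (⟦ st (w ∣[ 1 ‥ m ]) ∣[ 1 ‥ i ] ⟧ ⊗ₑ (⟦ st (w ∣[ 1 ‥ m ]) ∣[ suc i ‥ i + j ] ⟧ ⊗ₑ ⟦ w ∣[ suc m ‥ m + k ] ⟧))
          D³.≈ cut i j k
      cut-left eq i j refl = rel (⊗-cong
        (⟦⟧-cong (st-restrict-restrict w-perm 0 (i + j) 0 i (left≤ eq) (ℕ.m≤m+n i j)))
        (⊗-congʳ D D (⟦⟧-cong (st-restrict-restrict w-perm 0 (i + j) i j (left≤ eq) ℕ.≤-refl))))

      cut-right : ∀ {i m} → i + m ≡ n → ∀ j k → j + k ≡ m →
        (⟦ w ∣[ 1 ‥ i ] ⟧ ⊗ₑ (⟦ st (w ∣[ suc i ‥ i + m ]) ∣[ 1 ‥ j ] ⟧ ⊗ₑ ⟦ st (w ∣[ suc i ‥ i + m ]) ∣[ suc j ‥ j + k ] ⟧))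
          D³.≈ cut i j k
      cut-right {i} eq j k refl = ⊗-congˡ D D² (rel (⊗-cong
        (⟦⟧-cong (trans (st-restrict-restrict w-perm i (j + k) 0 j (ℕ.≤-reflexive eq) (ℕ.m≤m+n j k))
          -- The inner cut has offset 0, which leaves `i + 0` as the lower end.
          (cong (λ a → st (w ∣[ suc a ‥ a + j ])) (ℕ.+-identityʳ i))))
        (⟦⟧-cong (st-restrict-restrict w-perm i (j + k) j k (ℕ.≤-reflexive eq) ℕ.≤-refl))))

    -- Both sides become the sum of `cut i j k` over i + j + k = n, once the standardizations
    -- between the two cuts are absorbed.
    coassoc-gen : associator D D D (tensorMap D² D Δ id (Δ (gen p))) D³.≈ tensorMap D D² id Δ (Δ (gen p))
    coassoc-gen = begin
      associator D D D (tensorMap D² D Δ id (Δ (gen p)))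
        ≈⟨ Δ-expand D³ {associator D D D ∘ tensorMap D² D Δ id}
             (record { 𝟘-homo = D³.refl ; ⊕-homo = λ _ _ → D³.refl ; ⊖-homo = λ _ → D³.refl }) p refl ⟩
      antidiagonal D³ n (λ m k → associate (⟦ w ∣[ suc m ‥ m + k ] ⟧) (Δ ⟦ w ∣[ 1 ‥ m ] ⟧))
        ≈⟨ antidiagonal-cong D³ n (λ m k eq →
             D³.trans (Δ-expand D³ (extend-hom D³ _) (std (w ∣[ 1 ‥ m ])) (trans (length-st (w ∣[ 1 ‥ m ])) (length-left eq)))
                      (antidiagonal-cong D³ m (cut-left eq))) ⟩
      antidiagonal D³ n (λ m k → antidiagonal D³ m (λ i j → cut i j k))
        ≈⟨ antidiagonal-assoc D³ n cut ⟩
      antidiagonal D³ n (λ i m → antidiagonal D³ m (cut i))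
        ≈⟨ antidiagonal-cong D³ n (λ i m eq →
             D³.trans (Δ-expand D³ (additive-hom D³ (⊗-congˡ D D²) (λ s t → rel (⊗-distˡ _ s t)))
                        (std (w ∣[ suc i ‥ i + m ])) (trans (length-st (w ∣[ suc i ‥ i + m ])) (length-right eq)))
                      (antidiagonal-cong D³ m (cut-right eq))) ⟨
      antidiagonal D³ n (λ i m → ⟦ w ∣[ 1 ‥ i ] ⟧ ⊗ₑ Δ ⟦ w ∣[ suc i ‥ i + m ] ⟧)
        ≈⟨ Δ-expand D³ (extend-hom D³ _) p refl ⟨
      tensorMap D D² id Δ (Δ (gen p)) ∎
      where
      open SetoidReasoning D³.setoid
      associate : ∣ D ∣ → ∣ D² ∣ → ∣ D³ ∣
      associate c = extend D³ (λ (a , b) → a ⊗ₑ (b ⊗ₑ c))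

    whole : ⟦ w ∣[ 1 ‥ n ] ⟧ D.≈ gen p
    whole = ≈⇒D {⟦ w ∣[ 1 ‥ n ] ⟧} {gen p} (gen-cong′ (trans (cong st (restrict-all w-perm)) (st-permutation w-perm)))

    -- The left part of the cut at `i` has length `i`, so the counit kills every summand except i =
    -- 0, where the right part is the whole word.
    counitˡ-gen : tensorMap ℤ-group D counit id (Δ (gen p)) ℤD.≈ 1ℤ ⊗ₑ gen p
    counitˡ-gen = begin
      tensorMap ℤ-group D counit id (Δ (gen p))         ≈⟨ Δ-expand ℤD (extend-hom ℤD _) p refl ⟩
      antidiagonal ℤD n (λ i j → counit ⟦ w ∣[ 1 ‥ i ] ⟧ ⊗ₑ ⟦ w ∣[ suc i ‥ i + j ] ⟧)
        ≈⟨ antidiagonal-first ℤD n (λ i j eq → ℤD.trans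
             (⊗-congʳ ℤ-group D (counit-positive (w ∣[ 1 ‥ suc i ]) (length-left eq))) (⊗-εˡ ℤ-group D _)) ⟩
      counit ⟦ w ∣[ 1 ‥ 0 ] ⟧ ⊗ₑ ⟦ w ∣[ 1 ‥ n ] ⟧
        ≈⟨ rel (⊗-cong (counit-empty (w ∣[ 1 ‥ 0 ]) (length-left {0} {n} refl)) whole) ⟩
      1ℤ ⊗ₑ gen p                                       ∎
      where open SetoidReasoning ℤD.setoid

    counitʳ-gen : tensorMap D ℤ-group id counit (Δ (gen p)) Dℤ.≈ gen p ⊗ₑ 1ℤ
    counitʳ-gen = begin
      tensorMap D ℤ-group id counit (Δ (gen p))         ≈⟨ Δ-expand Dℤ (extend-hom Dℤ _) p refl ⟩
      antidiagonal Dℤ n (λ i j → ⟦ w ∣[ 1 ‥ i ] ⟧ ⊗ₑ counit ⟦ w ∣[ suc i ‥ i + j ] ⟧)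
        ≈⟨ antidiagonal-last Dℤ n (λ i j eq → Dℤ.trans
             (⊗-congˡ D ℤ-group (counit-positive (w ∣[ suc i ‥ i + suc j ]) (length-right eq))) (⊗-εʳ D ℤ-group _)) ⟩
      ⟦ w ∣[ 1 ‥ n ] ⟧ ⊗ₑ counit ⟦ w ∣[ suc n ‥ n + 0 ] ⟧
        ≈⟨ rel (⊗-cong whole (counit-empty (w ∣[ suc n ‥ n + 0 ]) (length-right {n} {0} (ℕ.+-identityʳ n)))) ⟩
      gen p ⊗ₑ 1ℤ                                       ∎
      where open SetoidReasoning Dℤ.setoid

  isCoalgebra : IsCoalgebra D Δ counit
  isCoalgebra = record
    { Δ-linear = additive-linear D D² (λ {a} {b} → Δ-cong {a} {b}) (λ _ _ → D².refl)
    ; ε-linear = additive-linear D ℤ-group (λ {a} {b} → counit-cong {a} {b}) (λ _ _ → refl)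
    ; coassoc  = termHom-ext D³
        (record { 𝟘-homo = D³.refl ; ⊕-homo = λ _ _ → D³.refl ; ⊖-homo = λ _ → D³.refl })
        (record { 𝟘-homo = D³.refl ; ⊕-homo = λ _ _ → D³.refl ; ⊖-homo = λ _ → D³.refl }) coassoc-gen
    ; counitˡ  = termHom-ext ℤD
        (record { 𝟘-homo = ℤD.refl ; ⊕-homo = λ _ _ → ℤD.refl ; ⊖-homo = λ _ → ℤD.refl })
        (additive-hom ℤD (λ {a} {b} a≈b → ⊗-congˡ ℤ-group D (≈⇒D {a} {b} a≈b)) (λ s t → rel (⊗-distˡ _ s t))) counitˡ-gen
    ; counitʳ  = termHom-ext Dℤ
        (record { 𝟘-homo = Dℤ.refl ; ⊕-homo = λ _ _ → Dℤ.refl ; ⊖-homo = λ _ → Dℤ.refl })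
        (additive-hom Dℤ (λ {a} {b} a≈b → ⊗-congʳ D ℤ-group (≈⇒D {a} {b} a≈b)) (λ s t → rel (⊗-distʳ s t _))) counitʳ-gen
    }

-- The ring PR and its right module and quotient coalgebra SPR

private
  module K  = SwapIdeal knuthMoves
  module SK = SwapIdeal shiftedKnuthMoves
  module PR = AbelianGroup PR
  module SPR = AbelianGroup SPR

J-K⊆J-SK : ∀ {a} → J-K a → J-SK a
J-K⊆J-SK = span-mono λ { (u , v , u≡v , eq) → u , v , EqClosure.map knuth u≡v , eq }

ℤ𝔖-≈⇒PR : ∀ {a b} → a ℤ𝔖.≈ b → a PR.≈ b
ℤ𝔖-≈⇒PR {a} {b} = K.≈⇒Q {a} {b}

✶-cong-PRʳ : ∀ a {b b′} → b PR.≈ b′ → a ✶ b PR.≈ a ✶ b′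
✶-cong-PRʳ a {b} {b′} b≈b′ = termHom-difference⁻ PR (quotient-hom ℤ𝔖 K.J-isSubgroup (✶-homʳ a)) {b} {b′}
  (∈⇒quotient-ε ℤ𝔖 K.J-isSubgroup (K.✶-absorbsˡ knuthAt-drop⁻ a b≈b′))

*PR-cong : ∀ {a a′ b b′} → a PR.≈ a′ → b PR.≈ b′ → a ✶ b PR.≈ a′ ✶ b′
*PR-cong {a} {a′} {b} {b′} a≈a′ b≈b′ =
  PR.trans {a ✶ b} {a ✶ b′} {a′ ✶ b′} (✶-cong-PRʳ a {b} {b′} b≈b′) (K.✶-absorbs b′ a≈a′)

-- Changing `a` alters the product by an element of J_K, a left ideal contained in J_SK; changing
-- `m` alters it by an element of the right ideal J_SK.
·-cong : ∀ {m m′ a a′} → m SPR.≈ m′ → a PR.≈ a′ → m ✶ a SPR.≈ m′ ✶ a′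
·-cong {m} {m′} {a} {a′} m≈m′ a≈a′ =
  SPR.trans {m ✶ a} {m ✶ a′} {m′ ✶ a′} (J-K⊆J-SK (✶-cong-PRʳ m {a} {a′} a≈a′)) (SK.✶-absorbs a′ m≈m′)

✶-distribˡ : ∀ a b c → a ✶ (b ⊕ c) ℤ𝔖.≈ (a ✶ b) ⊕ (a ✶ c)
✶-distribˡ a = ⊕-homo (✶-homʳ a)

PR-isRing : IsRing PR._≈_ PR._∙_ _*PR_ PR._⁻¹ PR.ε 𝟙
PR-isRing = record
  { +-isAbelianGroup = PR.isAbelianGroup
  ; *-cong           = λ {a} {a′} {b} {b′} → *PR-cong {a} {a′} {b} {b′}
  ; *-assoc          = λ a b c → ℤ𝔖-≈⇒PR {(a ✶ b) ✶ c} {a ✶ (b ✶ c)} (✶-assoc a b c)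
  ; *-identity       = (λ a → ℤ𝔖-≈⇒PR {𝟙 ✶ a} {a} (✶-identityˡ a)) , (λ a → ℤ𝔖-≈⇒PR {a ✶ 𝟙} {a} (✶-identityʳ a))
  ; distrib          = (λ a b c → ℤ𝔖-≈⇒PR {a ✶ (b ⊕ c)} {(a ✶ b) ⊕ (a ✶ c)} (✶-distribˡ a b c)) ,
                       (λ c a b → PR.refl {(a ⊕ b) ✶ c})
  }

SPR-isRightModule : IsRightModule (record { isRing = PR-isRing }) SPR._≈_ SPR._∙_ SPR.ε SPR._⁻¹ _·_
SPR-isRightModule = record
  { isRightSemimodule = record
    { +ᴹ-isCommutativeMonoid = SPR.isCommutativeMonoid
    ; isPrerightSemimodule = record
      { *ᵣ-cong      = λ {m} {m′} {a} {a′} → ·-cong {m} {m′} {a} {a′}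
      ; *ᵣ-zeroʳ     = λ m → SK.≈⇒Q {m ✶ 𝟘} {𝟘} (𝟘-homo (✶-homʳ m))
      ; *ᵣ-distribˡ  = λ m a b → SK.≈⇒Q {m ✶ (a ⊕ b)} {(m ✶ a) ⊕ (m ✶ b)} (✶-distribˡ m a b)
      ; *ᵣ-identityʳ = λ m → SK.≈⇒Q {m ✶ 𝟙} {m} (✶-identityʳ m)
      ; *ᵣ-assoc     = λ m a b → SK.≈⇒Q {(m ✶ a) ✶ b} {m ✶ (a ✶ b)} (✶-assoc m a b)
      ; *ᵣ-zeroˡ     = λ a → SPR.refl {𝟘}
      ; *ᵣ-distribʳ  = λ a m m′ → SPR.refl {(m ⊕ m′) ✶ a}
      }
    }
  ; -ᴹ‿cong    = λ {m} {m′} → SPR.⁻¹-cong {m} {m′}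
  ; -ᴹ‿inverse = SPR.inverse
  }

theorem4p1 : IsRightIdeal ℤ𝔖 _✶_ J-SK
    × IsCoideal ℤ𝔖 Δ counit J-SK
    × Σ (IsRing (AbelianGroup._≈_ PR) (AbelianGroup._∙_ PR) _*PR_ (AbelianGroup._⁻¹ PR) (AbelianGroup.ε PR) 𝟙)
    (λ PR-isRing →
    IsRightModule (record { isRing = PR-isRing })
    (AbelianGroup._≈_ SPR) (AbelianGroup._∙_ SPR) (AbelianGroup.ε SPR) (AbelianGroup._⁻¹ SPR) _·_)
    × IsQuotientCoalgebra PR Δ-PR counit SPR Δ-SPR counit projection
theorem4p1 =
  record { isSubgroup = SK.J-isSubgroup ; absorbs = SK.✶-absorbs } ,
  SK.coideal ,
  (PR-isRing , SPR-isRightModule) ,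
  record
    { isCoalgebra  = QuotientCoalgebra.isCoalgebra K.coideal
    ; isCoalgebra′ = QuotientCoalgebra.isCoalgebra SK.coideal
    ; π-linear     = additive-linear PR SPR J-K⊆J-SK (λ a b → SPR.refl {a ⊕ b})
    -- Every element is its own preimage; surjectivity also asks that all elements equal to it in PR
    -- be sent to the same class.
    ; π-surjective = λ a → a , J-K⊆J-SK
    -- `projection` is the identity, but `tensorMap` rebuilds the term, so agreement is shown on
    -- generators and extended.
    ; π-Δ          = termHom-ext SPR² id-hom (extend-hom SPR² _) (λ _ → SPR².refl) ∘ Δ
    ; π-ε          = λ _ → refl
    }
  where
  SPR² : Ab
  SPR² = SPR ⊗ SPR
  module SPR² = AbelianGroup SPR²
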